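{- Let $G\le\mathrm{Sym}_n$. Then there exists a self-dual binary code $C\le\mathbb{F}_2^n$ with $G\le\mathrm{Aut}(C)$ if and only if every self-dual simple $\mathbb{F}_2G$-module $S$ occurs in the $\mathbb{F}_2G$-module $\mathbb{F}_2^n$ (as a composition factor) with even multiplicity.
   Context: $\mathrm{Sym}_n$ acts on $\mathbb{F}_2^n$ by permuting coordinates, making $\mathbb{F}_2^n$ an $\mathbb{F}_2G$-module. A code $C\le \mathbb{F}_2^n$ is self-dual if $C=C^\perp=\{v\mid \sum_i v_ic_i=0\ \forall c\in C\}$. $\mathrm{Aut}(C)=\{\pi\in\mathrm{Sym}_n\mid C\pi=C\}$. For a right $\mathbb{F}_2G$-module $S$, the dual module is $S^*=\mathrm{Hom}_{\mathbb{F}_2}(S,\mathbb{F}_2)$ with $(fg)(s)=f(sg^{ -1})$; $S$ is self-dual if $S\cong S^*$. Multiplicity means the number of times $S$ occurs in a composition series. -}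

module Defs where

open import Data.Bool using (Bool; true; false; _xor_; _∧_; T)
open import Data.Nat using (ℕ; zero; suc; _+_; _≤_)
open import Data.Nat.Divisibility using (_∣_)
open import Data.Fin using (Fin; zero; suc; fromℕ; inject₁)
open import Data.Vec using (Vec; []; _∷_; lookup; tabulate; zipWith; replicate; allFin)
open import Data.Product using (Σ; ∃; _×_; _,_)
open import Data.Sum using (_⊎_)
open import Relation.Nullary using (¬_)
open import Relation.Binary.PropositionalEquality using (_≡_)
open import Function.Bundles using (_⇔_)

Vec₂ : ℕ → Set
Vec₂ d = Vec Bool d

infixl 6 _⊕_
_⊕_ : ∀ {d} → Vec₂ d → Vec₂ d → Vec₂ d
_⊕_ = zipWith _xor_

0v : ∀ {d} → Vec₂ d
0v = replicate _ false

dot : ∀ {d} → Vec₂ d → Vec₂ d → Bool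
dot []       []       = false
dot (a ∷ u) (b ∷ v) = (a ∧ b) xor dot u v

-- Elements of Sym_n, encoded as tables p with p[i] = p(i).
-- Composition is function composition (p ∘P q)(i) = p(q(i)).

Perm : ℕ → Set
Perm n = Vec (Fin n) n

idP : ∀ {n} → Perm n
idP = allFin _

_∘P_ : ∀ {n} → Perm n → Perm n → Perm n
p ∘P q = tabulate (λ i → lookup p (lookup q i))

-- coordinate permutation action on F₂^n; a right action:
-- (v ·P p) ·P q ≡ v ·P (p ∘P q)
_·P_ : ∀ {n} → Vec₂ n → Perm n → Vec₂ n
v ·P p = tabulate (λ j → lookup v (lookup p j))

-- G ≤ Sym_n, given as a (decidable) subset of Sym_n closed under
-- identity, composition and inverses.  (Any table with a right inverse
-- table is a bijection, so every member is a genuine permutation.)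
record IsSubgroup {n : ℕ} (G : Perm n → Bool) : Set where
  field
    id∈   : T (G idP)
    comp∈ : ∀ p q → T (G p) → T (G q) → T (G (p ∘P q))
    inv∈  : ∀ p → T (G p) → Σ (Perm n) (λ q → T (G q) × (p ∘P q ≡ idP))

Code : ℕ → Set
Code n = Vec₂ n → Bool

SelfDualCode : ∀ {n} → Code n → Set
SelfDualCode {n} C =
  (v : Vec₂ n) → T (C v) ⇔ ((c : Vec₂ n) → T (C c) → dot v c ≡ false)

_≤Aut_ : ∀ {n} → (Perm n → Bool) → Code n → Set
_≤Aut_ {n} G C = (p : Perm n) → T (G p) → (v : Vec₂ n) → C (v ·P p) ≡ C v

record Rep {n : ℕ} (G : Perm n → Bool) : Set where
  field
    dim    : ℕ
    act    : (p : Perm n) → T (G p) → Vec₂ dim → Vec₂ dim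
    act-⊕  : ∀ p (g : T (G p)) u v → act p g (u ⊕ v) ≡ act p g u ⊕ act p g v
    act-id : ∀ (g : T (G idP)) v → act idP g v ≡ v
    act-∘  : ∀ p q (gp : T (G p)) (gq : T (G q)) (gpq : T (G (p ∘P q))) v →
             act (p ∘P q) gpq v ≡ act q gq (act p gp v)
open Rep public

IsSubmodule : ∀ {n} (G : Perm n → Bool) (d : ℕ) →
  ((p : Perm n) → T (G p) → Vec₂ d → Vec₂ d) → (Vec₂ d → Bool) → Set
IsSubmodule {n} G d act W =
  T (W 0v) ×
  ((u v : Vec₂ d) → T (W u) → T (W v) → T (W (u ⊕ v))) ×
  ((p : Perm n) (g : T (G p)) (v : Vec₂ d) → T (W v) → T (W (act p g v)))

Simple : ∀ {n} {G : Perm n → Bool} → Rep G → Set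
Simple {n} {G} S =
  1 ≤ dim S ×
  ((W : Vec₂ (dim S) → Bool) → IsSubmodule G (dim S) (act S) W →
     ((v : Vec₂ (dim S)) → T (W v) → v ≡ 0v) ⊎ ((v : Vec₂ (dim S)) → T (W v)))

-- S ≅ S* = Hom_F₂(S, F₂) with (f g)(s) = f(s g⁻¹).
-- φ : S → S*, where an element of S* is an additive (= F₂-linear) map
-- S → F₂, compared pointwise.
SelfDualModule : ∀ {n} {G : Perm n → Bool} → Rep G → Set
SelfDualModule {n} {G} S =
  Σ (Vec₂ (dim S) → Vec₂ (dim S) → Bool) λ φ →
    ((u v t : Vec₂ (dim S)) → φ (u ⊕ v) t ≡ (φ u t xor φ v t)) ×
    ((s t t' : Vec₂ (dim S)) → φ s (t ⊕ t') ≡ (φ s t xor φ s t')) ×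
    -- φ is G-equivariant: φ(s g)(t) = (φ(s) g)(t) = φ(s)(t g⁻¹)
    ((p q : Perm n) (gp : T (G p)) (gq : T (G q)) → p ∘P q ≡ idP →
       (s t : Vec₂ (dim S)) → φ (act S p gp s) t ≡ φ s (act S q gq t)) ×
    ((s s' : Vec₂ (dim S)) → ((t : Vec₂ (dim S)) → φ s t ≡ φ s' t) → s ≡ s') ×
    ((f : Vec₂ (dim S) → Bool) →
       ((t t' : Vec₂ (dim S)) → f (t ⊕ t') ≡ (f t xor f t')) →
       Σ (Vec₂ (dim S)) λ s → (t : Vec₂ (dim S)) → φ s t ≡ f t)

permAct : ∀ {n} (G : Perm n → Bool) → (p : Perm n) → T (G p) → Vec₂ n → Vec₂ n
permAct G p _ v = v ·P p

IsPermSubmodule : ∀ {n} (G : Perm n → Bool) → (Vec₂ n → Bool) → Set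
IsPermSubmodule {n} G W = IsSubmodule G n (permAct G) W

_⊆_ : ∀ {n} → (Vec₂ n → Bool) → (Vec₂ n → Bool) → Set
_⊆_ {n} U W = (v : Vec₂ n) → T (U v) → T (W v)

record CompositionSeries {n : ℕ} (G : Perm n → Bool) : Set where
  field
    len    : ℕ
    W      : Fin (suc len) → Vec₂ n → Bool
    W-sub  : (i : Fin (suc len)) → IsPermSubmodule G (W i)
    W-zero : (v : Vec₂ n) → T (W zero v) → v ≡ 0v
    W-top  : (v : Vec₂ n) → T (W (fromℕ len) v)
    W-incl : (i : Fin len) → W (inject₁ i) ⊆ W (suc i)
    W-prop : (i : Fin len) →
             Σ (Vec₂ n) λ v → T (W (suc i) v) × ¬ T (W (inject₁ i) v)
    W-max  : (i : Fin len) (U : Vec₂ n → Bool) → IsPermSubmodule G U →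
             W (inject₁ i) ⊆ U → U ⊆ W (suc i) →
             (U ⊆ W (inject₁ i)) ⊎ (W (suc i) ⊆ U)
open CompositionSeries public

-- The i-th factor W_{i+1}/W_i is isomorphic to S: there is a G-linear
-- map W_{i+1} → S that is onto and has kernel exactly W_i.
FactorIso : ∀ {n} {G : Perm n → Bool} → (cs : CompositionSeries G) →
  Fin (len cs) → Rep G → Set
FactorIso {n} {G} cs i S =
  let Wt = W cs (suc i) ; Wb = W cs (inject₁ i) in
  Σ (Vec₂ n → Vec₂ (dim S)) λ f →
    ((u v : Vec₂ n) → T (Wt u) → T (Wt v) → f (u ⊕ v) ≡ f u ⊕ f v) ×
    ((p : Perm n) (g : T (G p)) (v : Vec₂ n) → T (Wt v) →
       f (v ·P p) ≡ act S p g (f v)) ×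
    ((s : Vec₂ (dim S)) → Σ (Vec₂ n) λ v → T (Wt v) × f v ≡ s) ×
    ((v : Vec₂ n) → T (Wt v) → (f v ≡ 0v) ⇔ T (Wb v))

countTrue : ∀ {k} → (Fin k → Bool) → ℕ
countTrue {zero}  m = 0
countTrue {suc k} m with m zero
... | true  = suc (countTrue (λ i → m (suc i)))
... | false = countTrue (λ i → m (suc i))

-- S occurs in F₂^n with even multiplicity: in every composition series
-- the number of factors isomorphic to S (counted via a marking that
-- flags exactly those factors) is even.
EvenMultiplicity : ∀ {n} (G : Perm n → Bool) → Rep G → Set
EvenMultiplicity G S =
  (cs : CompositionSeries G) (marks : Fin (len cs) → Bool) →
  ((i : Fin (len cs)) → T (marks i) ⇔ FactorIso cs i S) →
  2 ∣ countTrue marks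

{-# OPTIONS --safe #-}
module Submission where

-- Write mult U for the number of composition factors of U isomorphic to a fixed self-dual simple S. A
-- submodule U and its orthogonal together account for all of V = F₂^n, because V / U^⊥ is dual to U; so
-- mult U + mult U^⊥ = mult V, and U = U^⊥ makes mult V even.
--
-- Conversely let C be maximal among the self-orthogonal submodules, suppose C ≠ C^⊥, and let D be minimal
-- over C inside C^⊥. By maximality the form is nondegenerate on D/C, so S = D/C is self-dual, and since
-- mult V is even, mult D^⊥ - mult C is odd. Splitting nondegenerate simple pieces off D^⊥/C one finds a
-- D′/C ≅ S orthogonal to D/C. Any two invariant symmetric forms on S are isometric: they differ by an
-- automorphism α of S, α has odd order 2k+1 (an involution of S is trivial in characteristic 2), and
-- α^k is an isometry. The graph of an isometry D/C → D′/C is isotropic, contradicting the maximality of C.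

-- Jordan-Hölder is never proved. One composition series W of F₂^n is fixed, and the multiplicity of
-- S in a submodule U is the number of indices i with W_{i+1}/W_i isomorphic to S at which the chain
-- U ∩ W_i moves. Passing to a submodule that covers U adds exactly one moving index, and
-- Zassenhaus's lemma identifies the factor there with the new quotient. This additivity is all that
-- the parity argument needs.
--
-- The exponent k comes from self-adjointness. With forms read as maps S → S*, α = β⁻¹β′ is
-- self-adjoint for β because both forms are symmetric, so β′(α^k s, α^k t) = β(α^{k+1} s, α^k t) =
-- β(α^{2k+1} s, t). Thus α^k does the work of an inverse square root of α, and an odd exponent is
-- exactly what provides one.
--
-- The graph of an isometry is isotropic because the form on it takes each value twice and 2 = 0. It
-- is strictly larger than C because D′ is orthogonal to D while D/C is nondegenerate, so D and D′
-- meet only in C.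

open import Defs
import Level
open import Algebra using (CommutativeRing)
import Algebra.Properties.CommutativeMonoid.Sum as Sum
import Algebra.Properties.CommutativeSemigroup as CommutativeSemigroupProperties
open import Data.Bool using (Bool; true; false; _xor_; _∧_; T; not)
open import Data.Bool.Properties as Bool
  using (T?; xor-comm; xor-assoc; xor-same; xor-identityʳ; ∧-comm; ∧-zeroʳ; ∧-distribˡ-xor; xor-∧-commutativeRing)
open import Data.Empty using (⊥; ⊥-elim)
open import Data.Fin as Fin using (Fin; zero; suc; fromℕ; inject₁; combine)
import Data.Fin.Permutation as Permutation
open import Data.Fin.Properties as Fin using (combine-injective; pigeonhole; suc-injective)
open import Data.Nat as ℕ using (ℕ; zero; suc; _+_; _∸_; _^_; _≤_; _<_; z≤n; s≤s)
open import Data.Nat.Divisibility using (_∣_; divides; ∣1⇒≡1; ∣m+n∣m⇒∣n)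
open import Data.Nat.GeneralisedArithmetic using (fold; fold-+)
open import Data.Nat.Induction using (<-wellFounded; Acc; acc)
import Data.Nat.Properties as ℕ
open import Data.Product using (Σ; _×_; _,_; proj₁; proj₂; map₂)
open import Data.Sum using (_⊎_; inj₁; inj₂)
open import Data.Unit using (tt)
open import Data.Vec using (Vec; []; _∷_; lookup; tabulate)
open import Data.Vec.Properties as Vec
  using (zipWith-assoc; zipWith-comm; zipWith-identityˡ; zipWith-identityʳ; lookup-zipWith;
         lookup∘tabulate; tabulate∘lookup; tabulate-cong; ≡-dec; lookup-allFin)
open import Function using (_∘_; id; case_of_; _$_)
open import Function.Bundles using (_⇔_; mk⇔; Equivalence)
open import Relation.Binary.PropositionalEquality
  using (_≡_; _≢_; refl; sym; trans; cong; cong₂; subst; module ≡-Reasoning)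
open import Relation.Nullary using (¬_; Dec; yes; no; contradiction)
open import Relation.Nullary.Decidable
  using (⌊_⌋; map′; ¬?; _×-dec_; _→-dec_; decidable-stable; toWitness; fromWitness; ¬¬-excluded-middle)
open ≡-Reasoning
open Equivalence using (to; from)

-- Exhaustive search

Searchable : Set → Set₁
Searchable A = {P : A → Set} → (∀ a → Dec (P a)) → Dec (Σ A P)

bool-searchable : Searchable Bool
bool-searchable P? with P? true | P? false
... | yes p | _      = yes (true , p)
... | no _  | yes p  = yes (false , p)
... | no ¬t | no ¬f  = no λ { (true , p) → ¬t p ; (false , p) → ¬f p }

vec-searchable : {A : Set} → Searchable A → ∀ d → Searchable (Vec A d)
vec-searchable s zero    P? = map′ ([] ,_) (λ { ([] , p) → p }) (P? [])
vec-searchable s (suc d) P? =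
  map′ (λ (a , v , p) → a ∷ v , p) (λ { (a ∷ v , p) → a , v , p })
       (s λ a → vec-searchable s d λ v → P? (a ∷ v))

all? : {A : Set} → Searchable A → {P : A → Set} → (∀ a → Dec (P a)) → Dec (∀ a → P a)
all? s P? =
  map′ (λ ¬∃ a → decidable-stable (P? a) λ ¬p → ¬∃ (a , ¬p)) (λ f (a , ¬p) → ¬p (f a))
       (¬? (s λ a → ¬? (P? a)))

vec₂-searchable : ∀ {d} → Searchable (Vec₂ d)
vec₂-searchable = vec-searchable bool-searchable _

perm-searchable : ∀ {d} → Searchable (Perm d)
perm-searchable = vec-searchable Fin.any? _

glue : ∀ {d} → Code d → Code d → Code (suc d)
glue f g (true  ∷ v) = f v
glue f g (false ∷ v) = g v

-- A code is a function, and pointwise equal functions need not be equal, so `P` has to respect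
-- pointwise equality. The recursion splits a code into its restrictions to the two values of the
-- first coordinate.
code-search : ∀ d {P : Code d → Set} → (∀ f g → (∀ v → f v ≡ g v) → P f → P g) →
              (∀ f → Dec (P f)) → Dec (Σ (Code d) P)
code-search zero resp P? =
  map′ (λ (b , p) → (λ _ → b) , p) (λ (f , p) → f [] , resp f _ (λ { [] → refl }) p)
       (bool-searchable λ b → P? λ _ → b)
code-search (suc d) resp P? =
  map′ (λ (f , g , p) → glue f g , p)
       (λ (h , p) → h ∘ (true ∷_) , h ∘ (false ∷_) ,
                    resp h _ (λ { (true ∷ v) → refl ; (false ∷ v) → refl }) p)
       (code-search d
         (λ f f′ e (g , p) → g , resp _ _ (λ { (true ∷ v) → e v ; (false ∷ v) → refl }) p)
         λ f → code-search d
           (λ g g′ e → resp _ _ (λ { (true ∷ v) → refl ; (false ∷ v) → e v }))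
           λ g → P? (glue f g))

-- Linear algebra over F₂

_≟_ : ∀ {d} (u v : Vec₂ d) → Dec (u ≡ v)
_≟_ = ≡-dec Bool._≟_

open CommutativeSemigroupProperties
  (CommutativeRing.+-commutativeSemigroup xor-∧-commutativeRing)
  renaming (interchange to xor-interchange) using ()

xor≡false⇒≡ : ∀ {a b} → a xor b ≡ false → a ≡ b
xor≡false⇒≡ {true}  {true}  _ = refl
xor≡false⇒≡ {false} {false} _ = refl

true≢false : ∀ {b} → b ≡ true → ¬ (b ≡ false)
true≢false refl ()

⊕-comm : ∀ {d} (u v : Vec₂ d) → u ⊕ v ≡ v ⊕ u
⊕-comm = zipWith-comm xor-comm

⊕-assoc : ∀ {d} (u v w : Vec₂ d) → (u ⊕ v) ⊕ w ≡ u ⊕ (v ⊕ w)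
⊕-assoc = zipWith-assoc xor-assoc

⊕-identityˡ : ∀ {d} (v : Vec₂ d) → 0v ⊕ v ≡ v
⊕-identityˡ = zipWith-identityˡ (λ _ → refl)

⊕-identityʳ : ∀ {d} (v : Vec₂ d) → v ⊕ 0v ≡ v
⊕-identityʳ = zipWith-identityʳ xor-identityʳ

⊕-self : ∀ {d} (v : Vec₂ d) → v ⊕ v ≡ 0v
⊕-self []      = refl
⊕-self (a ∷ v) = cong₂ _∷_ (xor-same a) (⊕-self v)

⊕-cancelʳ : ∀ {d} (u v : Vec₂ d) → (u ⊕ v) ⊕ v ≡ u
⊕-cancelʳ u v = trans (⊕-assoc u v v) (trans (cong (u ⊕_) (⊕-self v)) (⊕-identityʳ u))

⊕-cancelˡ : ∀ {d} (u v : Vec₂ d) → u ⊕ (u ⊕ v) ≡ v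
⊕-cancelˡ u v = trans (sym (⊕-assoc u u v)) (trans (cong (_⊕ v) (⊕-self u)) (⊕-identityˡ v))

⊕-interchange : ∀ {d} (a b c e : Vec₂ d) → (a ⊕ b) ⊕ (c ⊕ e) ≡ (a ⊕ c) ⊕ (b ⊕ e)
⊕-interchange []      []      []      []      = refl
⊕-interchange (a ∷ u) (b ∷ v) (c ∷ w) (e ∷ x) = cong₂ _∷_ (xor-interchange a b c e) (⊕-interchange u v w x)

⊕≡0⇒≡ : ∀ {d} (u v : Vec₂ d) → u ⊕ v ≡ 0v → u ≡ v
⊕≡0⇒≡ u v e = trans (sym (⊕-cancelʳ u v)) (trans (cong (_⊕ v) e) (⊕-identityˡ v))

Additive : ∀ {d e} → (Vec₂ d → Vec₂ e) → Set
Additive f = ∀ u v → f (u ⊕ v) ≡ f u ⊕ f v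

additive-0 : ∀ {d e} (f : Vec₂ d → Vec₂ e) → Additive f → f 0v ≡ 0v
additive-0 f f-⊕ = begin
  f 0v            ≡⟨ cong f (⊕-self 0v) ⟨
  f (0v ⊕ 0v)     ≡⟨ f-⊕ 0v 0v ⟩
  f 0v ⊕ f 0v     ≡⟨ ⊕-self (f 0v) ⟩
  0v              ∎

Functional : ∀ {d} → (Vec₂ d → Bool) → Set
Functional h = ∀ u v → h (u ⊕ v) ≡ h u xor h v

functional-0 : ∀ {d} (h : Vec₂ d → Bool) → Functional h → h 0v ≡ false
functional-0 h h-⊕ = begin
  h 0v            ≡⟨ cong h (⊕-self 0v) ⟨
  h (0v ⊕ 0v)     ≡⟨ h-⊕ 0v 0v ⟩
  h 0v xor h 0v   ≡⟨ xor-same (h 0v) ⟩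
  false           ∎

dot-comm : ∀ {d} (u v : Vec₂ d) → dot u v ≡ dot v u
dot-comm []      []      = refl
dot-comm (a ∷ u) (b ∷ v) = cong₂ _xor_ (∧-comm a b) (dot-comm u v)

dot-⊕ʳ : ∀ {d} (u : Vec₂ d) → Functional (dot u)
dot-⊕ʳ []      []      []      = refl
dot-⊕ʳ (a ∷ u) (b ∷ v) (c ∷ w) =
  trans (cong₂ _xor_ (∧-distribˡ-xor a b c) (dot-⊕ʳ u v w)) (xor-interchange (a ∧ b) (a ∧ c) _ _)

dot-⊕ˡ : ∀ {d} (u v w : Vec₂ d) → dot (u ⊕ v) w ≡ dot u w xor dot v w
dot-⊕ˡ u v w = trans (dot-comm (u ⊕ v) w) (trans (dot-⊕ʳ w u v) (cong₂ _xor_ (dot-comm w u) (dot-comm w v)))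

dot-0ʳ : ∀ {d} (u : Vec₂ d) → dot u 0v ≡ false
dot-0ʳ u = functional-0 (dot u) (dot-⊕ʳ u)

dot-0ˡ : ∀ {d} (u : Vec₂ d) → dot 0v u ≡ false
dot-0ˡ u = trans (dot-comm 0v u) (dot-0ʳ u)

dot-⊕ʳ≡false : ∀ {d} (u v w : Vec₂ d) → dot u v ≡ false → dot u w ≡ false → dot u (v ⊕ w) ≡ false
dot-⊕ʳ≡false u v w p q = trans (dot-⊕ʳ u v w) (cong₂ _xor_ p q)

dot-representable : ∀ {d} (h : Vec₂ d → Bool) → Functional h → Σ (Vec₂ d) λ y → ∀ v → dot y v ≡ h v
dot-representable {zero}  h h-⊕ = [] , λ { [] → sym (functional-0 h h-⊕) }
dot-representable {suc d} h h-⊕ with dot-representable (h ∘ (false ∷_)) (λ u v → h-⊕ (false ∷ u) (false ∷ v))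
... | y , y-h = h (true ∷ 0v) ∷ y , λ
  { (false ∷ v) → trans (cong (_xor dot y v) (∧-zeroʳ (h (true ∷ 0v)))) (y-h v)
  ; (true  ∷ v) → begin
      (h (true ∷ 0v) ∧ true) xor dot y v    ≡⟨ cong₂ _xor_ (Bool.∧-identityʳ (h (true ∷ 0v))) (y-h v) ⟩
      h (true ∷ 0v) xor h (false ∷ v)       ≡⟨ h-⊕ (true ∷ 0v) (false ∷ v) ⟨
      h (true ∷ (0v ⊕ v))                   ≡⟨ cong (h ∘ (true ∷_)) (⊕-identityˡ v) ⟩
      h (true ∷ v)                          ∎ }

-- Membership is a decidable proposition rather than a Boolean, so that sums and orthogonals can be
-- defined by their quantifiers and decided by search.
record Subspace (d : ℕ) : Set₁ where
  field
    Mem  : Vec₂ d → Set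
    mem? : ∀ v → Dec (Mem v)
    ∋0   : Mem 0v
    ∋⊕   : ∀ {u v} → Mem u → Mem v → Mem (u ⊕ v)

  ∋-cancelʳ : ∀ u v → Mem (u ⊕ v) → Mem v → Mem u
  ∋-cancelʳ u v p q = subst Mem (⊕-cancelʳ u v) (∋⊕ p q)

  ∋-cancelˡ : ∀ u v → Mem (u ⊕ v) → Mem u → Mem v
  ∋-cancelˡ u v p q = subst Mem (⊕-cancelˡ u v) (∋⊕ q p)

open Subspace

-- Gaussian elimination on the first coordinate: a pivot `true ∷ w` in `U` clears that coordinate
-- from `v` and reduces the problem to `U₀`, the part of `U` whose first coordinate vanishes.
separation : ∀ {d} (U : Subspace d) v → ¬ Mem U v →
             Σ (Vec₂ d) λ y → (∀ u → Mem U u → dot y u ≡ false) × (dot y v ≡ true)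
separation {zero}  U []      v∉U = contradiction (∋0 U) v∉U
separation {suc d} U (a ∷ v) v∉U = by-pivot (vec₂-searchable λ w → mem? U (true ∷ w))
  where
  U₀ : Subspace d
  U₀ = record { Mem = Mem U ∘ (false ∷_) ; mem? = λ u → mem? U (false ∷ u) ; ∋0 = ∋0 U ; ∋⊕ = ∋⊕ U }

  Separator : Set
  Separator = Σ (Vec₂ (suc d)) λ y → (∀ u → Mem U u → dot y u ≡ false) × (dot y (a ∷ v) ≡ true)

  -- The first coefficient `dot g w` is forced: it is the only one for which the functional kills
  -- the pivot.
  extend : ∀ w → Mem U (true ∷ w) → (Σ (Vec₂ d) λ g → (∀ u → Mem U₀ u → dot g u ≡ false) × ((a ∧ dot g w) xor dot g v ≡ true)) →
           Separator
  extend w w∈U (g , g-U , g-v) = dot g w ∷ g , vanish , trans (cong (_xor dot g v) (∧-comm (dot g w) a)) g-v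
    where
    vanish : ∀ u → Mem U u → dot (dot g w ∷ g) u ≡ false
    vanish (false ∷ u) u∈U = trans (cong (_xor dot g u) (∧-zeroʳ (dot g w))) (g-U u u∈U)
    vanish (true  ∷ u) u∈U = trans (cong (_xor dot g u) (Bool.∧-identityʳ (dot g w)))
                                   (trans (sym (dot-⊕ʳ g w u)) (g-U (w ⊕ u) (∋⊕ U w∈U u∈U)))

  by-pivot : Dec (Σ (Vec₂ d) λ w → Mem U (true ∷ w)) → Separator
  by-pivot (yes (w , w∈U)) = extend w w∈U (shift a v∉U)
    where
    shift : ∀ b → ¬ Mem U (b ∷ v) → Σ (Vec₂ d) λ g → (∀ u → Mem U₀ u → dot g u ≡ false) × ((b ∧ dot g w) xor dot g v ≡ true)
    shift false v∉ = separation U₀ v v∉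
    shift true  v∉ with separation U₀ (w ⊕ v) (λ p → v∉ (∋-cancelˡ U (true ∷ w) (true ∷ v) p w∈U))
    ... | g , g-U , g-wv = g , g-U , trans (sym (dot-⊕ʳ g w v)) g-wv
  by-pivot (no ∄w) = no-pivot a v∉U
    where
    no-pivot : ∀ b → ¬ Mem U (b ∷ v) → Σ (Vec₂ (suc d)) λ y → (∀ u → Mem U u → dot y u ≡ false) × (dot y (b ∷ v) ≡ true)
    -- Without a pivot the first coordinate is itself a functional that vanishes on `U`.
    no-pivot true  _  = true ∷ 0v , (λ { (true ∷ u) p → contradiction (u , p) ∄w ; (false ∷ u) p → dot-0ˡ u }) , cong not (dot-0ˡ v)
    no-pivot false v∉ with separation U₀ v v∉
    ... | g , g-U , g-v = false ∷ g , (λ { (true ∷ u) p → contradiction (u , p) ∄w ; (false ∷ u) p → g-U u p }) , g-v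

double-perp : ∀ {d} (U : Subspace d) v → (∀ y → (∀ u → Mem U u → dot y u ≡ false) → dot y v ≡ false) → Mem U v
double-perp U v v⊥⊥ = decidable-stable (mem? U v) λ v∉U →
  let (y , y-U , y-v) = separation U v v∉U in true≢false y-v (v⊥⊥ y y-U)

-- Cardinalities

indicator : {P : Set} → Dec P → ℕ
indicator (yes _) = 1
indicator (no _)  = 0

indicator-mono : {P Q : Set} (P? : Dec P) (Q? : Dec Q) → (P → Q) → indicator P? ≤ indicator Q?
indicator-mono (yes p) (yes q) f = ℕ.≤-refl
indicator-mono (yes p) (no ¬q) f = contradiction (f p) ¬q
indicator-mono (no ¬p) Q?      f = z≤n

indicator-strict : {P Q : Set} (P? : Dec P) (Q? : Dec Q) → ¬ P → Q → indicator P? < indicator Q?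
indicator-strict (yes p) Q?      ¬p q = contradiction p ¬p
indicator-strict (no _)  (yes _) ¬p q = ℕ.≤-refl
indicator-strict (no _)  (no ¬q) ¬p q = contradiction q ¬q

card : ∀ {d} {P : Vec₂ d → Set} → (∀ v → Dec (P v)) → ℕ
card {zero}  P? = indicator (P? [])
card {suc d} P? = card (P? ∘ (true ∷_)) + card (P? ∘ (false ∷_))

card-mono : ∀ {d} {P Q : Vec₂ d → Set} (P? : ∀ v → Dec (P v)) (Q? : ∀ v → Dec (Q v)) →
            (∀ v → P v → Q v) → card P? ≤ card Q?
card-mono {zero}  P? Q? f = indicator-mono (P? []) (Q? []) (f [])
card-mono {suc d} P? Q? f =
  ℕ.+-mono-≤ (card-mono (P? ∘ (true ∷_)) (Q? ∘ (true ∷_)) (f ∘ (true ∷_)))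
             (card-mono (P? ∘ (false ∷_)) (Q? ∘ (false ∷_)) (f ∘ (false ∷_)))

card-strict : ∀ {d} {P Q : Vec₂ d → Set} (P? : ∀ v → Dec (P v)) (Q? : ∀ v → Dec (Q v)) →
              (∀ v → P v → Q v) → ∀ v → ¬ P v → Q v → card P? < card Q?
card-strict {zero}  P? Q? f []          = indicator-strict (P? []) (Q? [])
card-strict {suc d} P? Q? f (true ∷ v)  ¬p q =
  ℕ.+-mono-<-≤ (card-strict (P? ∘ (true ∷_)) (Q? ∘ (true ∷_)) (f ∘ (true ∷_)) v ¬p q)
               (card-mono (P? ∘ (false ∷_)) (Q? ∘ (false ∷_)) (f ∘ (false ∷_)))
card-strict {suc d} P? Q? f (false ∷ v) ¬p q =
  ℕ.+-mono-≤-< (card-mono (P? ∘ (true ∷_)) (Q? ∘ (true ∷_)) (f ∘ (true ∷_)))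
               (card-strict (P? ∘ (false ∷_)) (Q? ∘ (false ∷_)) (f ∘ (false ∷_)) v ¬p q)

-- For arbitrary `P` there is no way to decide whether a smaller element exists, so well-founded
-- descent gives the minimum only under a double negation.
¬¬-minimal : {A : Set₁} {P : A → Set₁} (size : A → ℕ) → ∀ a → P a →
             ¬ ¬ Σ A λ b → P b × (∀ c → P c → ¬ (size c < size b))
¬¬-minimal {A} {P} size a p k = descend a p (<-wellFounded _)
  where
  descend : ∀ b → P b → Acc _<_ (size b) → ⊥
  descend b q (acc rs) = k (b , q , λ c r c<b → descend c r (rs c<b))

¬¬-finite-choice : ∀ {k} {P : Fin k → Set} → (∀ i → ¬ ¬ P i) → ¬ ¬ (∀ i → P i)
¬¬-finite-choice {zero}  f κ = κ λ ()
¬¬-finite-choice {suc k} f κ =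
  f zero λ p → ¬¬-finite-choice (f ∘ suc) λ q → κ λ { zero → p ; (suc i) → q i }

-- Sections of F₂^d in coordinates

-- A `Rep` lives on some `Vec₂ dim`, so the quotient `D/C` has to be presented as a coordinate
-- space. `coord` is additive everywhere, but only its restriction to `D` has kernel `C`.
record Coordinates {d} (C D : Subspace d) : Set where
  field
    rank  : ℕ
    coord : Vec₂ d → Vec₂ rank
    coord-⊕    : Additive coord
    coord-onto : ∀ s → Σ (Vec₂ d) λ v → Mem D v × (coord v ≡ s)
    kernel⇒    : ∀ v → Mem D v → coord v ≡ 0v → Mem C v
    kernel⇐    : ∀ v → Mem C v → coord v ≡ 0v

-- A vector of `D` outside `C` is separated from `C` by some `y`; `dot y` becomes one coordinate,
-- and its kernel in `D` is a smaller space that still contains `C`.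
coordinates : ∀ {d} (C D : Subspace d) → (∀ v → Mem C v → Mem D v) → Coordinates C D
coordinates {d} C D = rec D (<-wellFounded _)
  where
  rec : (D : Subspace d) → Acc _<_ (card (mem? D)) → (∀ v → Mem C v → Mem D v) → Coordinates C D
  rec D (acc rs) C⊆D with vec₂-searchable (λ v → mem? D v ×-dec ¬? (mem? C v))
  ... | no D⊆C = record
    { rank = 0 ; coord = λ _ → [] ; coord-⊕ = λ _ _ → refl
    ; coord-onto = λ { [] → 0v , ∋0 D , refl }
    ; kernel⇒ = λ v v∈D _ → decidable-stable (mem? C v) λ v∉C → D⊆C (v , v∈D , v∉C)
    ; kernel⇐ = λ _ _ → refl }
  ... | yes (v , v∈D , v∉C) with separation C v v∉C
  ... | y , y-C , y-v = record
    { rank = suc rank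
    ; coord = λ w → dot y w ∷ coord w
    ; coord-⊕ = λ u w → cong₂ _∷_ (dot-⊕ʳ y u w) (coord-⊕ u w)
    ; coord-onto = onto
    ; kernel⇒ = λ w w∈D e → kernel⇒ w (w∈D , cong Data.Vec.head e) (cong Data.Vec.tail e)
    ; kernel⇐ = λ w w∈C → cong₂ _∷_ (y-C w w∈C) (kernel⇐ w w∈C) }
    where
    D₁ : Subspace d
    D₁ = record
      { Mem  = λ w → Mem D w × dot y w ≡ false
      ; mem? = λ w → mem? D w ×-dec (dot y w Bool.≟ false)
      ; ∋0   = ∋0 D , dot-0ʳ y
      ; ∋⊕   = λ {u} {w} (p , q) (p′ , q′) → ∋⊕ D p p′ , dot-⊕ʳ≡false y u w q q′ }
    open Coordinates
      (rec D₁ (rs (card-strict (mem? D₁) (mem? D) (λ _ → proj₁) v (λ (_ , e) → true≢false y-v e) v∈D))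
              (λ w w∈C → C⊆D w w∈C , y-C w w∈C))
    onto : ∀ s → Σ (Vec₂ d) λ w → Mem D w × (dot y w ∷ coord w ≡ s)
    onto (false ∷ s) with coord-onto s
    ... | w , (w∈D , y-w) , e = w , w∈D , cong₂ _∷_ y-w e
    -- Adding `v` switches on the new coordinate and shifts the old ones by `coord v`; the target is
    -- shifted beforehand to compensate.
    onto (true ∷ s) with coord-onto (s ⊕ coord v)
    ... | w , (w∈D , y-w) , e = w ⊕ v , ∋⊕ D w∈D v∈D , cong₂ _∷_
      (trans (dot-⊕ʳ y w v) (cong₂ _xor_ y-w y-v))
      (trans (coord-⊕ w v) (trans (cong (_⊕ coord v) e) (⊕-cancelʳ s (coord v))))

choose-on : ∀ {d e} (U : Subspace d) {R : Vec₂ d → Vec₂ e → Set} →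
            (∀ v → Mem U v → Σ (Vec₂ e) (R v)) → Σ (Vec₂ d → Vec₂ e) λ f → ∀ v → Mem U v → R v (f v)
choose-on {d} {e} U {R} total = (λ v → proj₁ (pick v (mem? U v))) , λ v → proj₂ (pick v (mem? U v))
  where
  pick : ∀ v → Dec (Mem U v) → Σ (Vec₂ e) λ s → Mem U v → R v s
  pick v (yes p) = let (s , r) = total v p in s , λ _ → r
  pick v (no ¬p) = 0v , λ p → contradiction p ¬p

-- Counting

+-interchange : ∀ a b c d → (a + b) + (c + d) ≡ (a + c) + (b + d)
+-interchange = CommutativeSemigroupProperties.interchange ℕ.+-commutativeSemigroup

bool→ℕ : Bool → ℕ
bool→ℕ true  = 1
bool→ℕ false = 0

countTrue-suc : ∀ {k} (m : Fin (suc k) → Bool) → countTrue m ≡ bool→ℕ (m zero) + countTrue (m ∘ suc)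
countTrue-suc m with m zero
... | true  = refl
... | false = refl

countTrue-cong : ∀ {k} (m m′ : Fin k → Bool) → (∀ i → m i ≡ m′ i) → countTrue m ≡ countTrue m′
countTrue-cong {zero}  m m′ e = refl
countTrue-cong {suc k} m m′ e = begin
  countTrue m                                    ≡⟨ countTrue-suc m ⟩
  bool→ℕ (m zero) + countTrue (m ∘ suc)
    ≡⟨ cong₂ (λ b → bool→ℕ b +_) (e zero) (countTrue-cong (m ∘ suc) (m′ ∘ suc) (e ∘ suc)) ⟩
  bool→ℕ (m′ zero) + countTrue (m′ ∘ suc)        ≡⟨ countTrue-suc m′ ⟨
  countTrue m′                                   ∎

countTrue-false : ∀ {k} (m : Fin k → Bool) → (∀ i → m i ≡ false) → countTrue m ≡ 0
countTrue-false {zero}  m e = refl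
countTrue-false {suc k} m e =
  trans (countTrue-suc m) (cong₂ (λ b → bool→ℕ b +_) (e zero) (countTrue-false (m ∘ suc) (e ∘ suc)))

countTrue-single : ∀ {k} (m m′ : Fin k → Bool) i → (∀ j → j ≢ i → m j ≡ m′ j) → m′ i ≡ false →
                   countTrue m ≡ bool→ℕ (m i) + countTrue m′
countTrue-single m m′ zero e m′i = begin
  countTrue m                                          ≡⟨ countTrue-suc m ⟩
  bool→ℕ (m zero) + countTrue (m ∘ suc)
    ≡⟨ cong (bool→ℕ (m zero) +_) (countTrue-cong _ _ λ j → e (suc j) λ ()) ⟩
  bool→ℕ (m zero) + countTrue (m′ ∘ suc)
    ≡⟨ cong (λ b → bool→ℕ (m zero) + (bool→ℕ b + countTrue (m′ ∘ suc))) m′i ⟨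
  bool→ℕ (m zero) + (bool→ℕ (m′ zero) + countTrue (m′ ∘ suc))
    ≡⟨ cong (bool→ℕ (m zero) +_) (countTrue-suc m′) ⟨
  bool→ℕ (m zero) + countTrue m′                       ∎
countTrue-single m m′ (suc i) e m′i = begin
  countTrue m                                          ≡⟨ countTrue-suc m ⟩
  bool→ℕ (m zero) + countTrue (m ∘ suc)
    ≡⟨ cong₂ (λ b → bool→ℕ b +_) (e zero λ ())
         (countTrue-single (m ∘ suc) (m′ ∘ suc) i (λ j j≢i → e (suc j) (j≢i ∘ suc-injective)) m′i) ⟩
  bool→ℕ (m′ zero) + (bool→ℕ (m (suc i)) + countTrue (m′ ∘ suc))
    ≡⟨ +-interchange 0 (bool→ℕ (m′ zero)) (bool→ℕ (m (suc i))) (countTrue (m′ ∘ suc)) ⟩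
  bool→ℕ (m (suc i)) + (bool→ℕ (m′ zero) + countTrue (m′ ∘ suc))
    ≡⟨ cong (bool→ℕ (m (suc i)) +_) (countTrue-suc m′) ⟨
  bool→ℕ (m (suc i)) + countTrue m′                    ∎

countTrue-split : ∀ {k} (m j : Fin k → Bool) →
                  countTrue m ≡ countTrue (λ i → m i ∧ j i) + countTrue (λ i → m i ∧ not (j i))
countTrue-split {zero}  m j = refl
countTrue-split {suc k} m j = begin
  countTrue m                              ≡⟨ countTrue-suc m ⟩
  bool→ℕ (m zero) + countTrue (m ∘ suc)
    ≡⟨ cong₂ _+_ (split (m zero) (j zero)) (countTrue-split (m ∘ suc) (j ∘ suc)) ⟩
  (bool→ℕ (m zero ∧ j zero) + bool→ℕ (m zero ∧ not (j zero))) +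
  (countTrue (λ i → m (suc i) ∧ j (suc i)) + countTrue (λ i → m (suc i) ∧ not (j (suc i))))
    ≡⟨ +-interchange (bool→ℕ (m zero ∧ j zero)) _ _ _ ⟩
  (bool→ℕ (m zero ∧ j zero) + countTrue (λ i → m (suc i) ∧ j (suc i))) +
  (bool→ℕ (m zero ∧ not (j zero)) + countTrue (λ i → m (suc i) ∧ not (j (suc i))))
    ≡⟨ cong₂ _+_ (countTrue-suc (λ i → m i ∧ j i)) (countTrue-suc (λ i → m i ∧ not (j i))) ⟨
  countTrue (λ i → m i ∧ j i) + countTrue (λ i → m i ∧ not (j i)) ∎
  where
  split : ∀ a b → bool→ℕ a ≡ bool→ℕ (a ∧ b) + bool→ℕ (a ∧ not b)
  split true  true  = refl
  split true  false = refl
  split false b     = refl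

telescope : ∀ {k} (g : Fin (suc k) → ℕ) (m : Fin k → Bool) →
            (∀ i → g (inject₁ i) ≡ bool→ℕ (m i) + g (suc i)) → g zero ≡ countTrue m + g (fromℕ k)
telescope {zero}  g m e = refl
telescope {suc k} g m e = begin
  g zero                                                   ≡⟨ e zero ⟩
  bool→ℕ (m zero) + g (suc zero)
    ≡⟨ cong (bool→ℕ (m zero) +_) (telescope (g ∘ suc) (m ∘ suc) (e ∘ suc)) ⟩
  bool→ℕ (m zero) + (countTrue (m ∘ suc) + g (fromℕ (suc k))) ≡⟨ ℕ.+-assoc (bool→ℕ (m zero)) _ _ ⟨
  bool→ℕ (m zero) + countTrue (m ∘ suc) + g (fromℕ (suc k))   ≡⟨ cong (_+ g (fromℕ (suc k))) (countTrue-suc m) ⟨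
  countTrue m + g (fromℕ (suc k))                             ∎

-- A downward closed property that holds at the bottom and fails at the top is lost at exactly one
-- step. The last clause says that every other step stays on one side of the threshold.
crossing : ∀ {k} {P : Fin (suc k) → Set} → (∀ i → Dec (P i)) → (∀ i → P (suc i) → P (inject₁ i)) →
           P zero → ¬ P (fromℕ k) →
           Σ (Fin k) λ i → P (inject₁ i) × ¬ P (suc i) × (∀ j → j ≢ i → P (suc j) ⊎ ¬ P (inject₁ j))
crossing {zero}      P? mono p₀ ¬pₖ = contradiction p₀ ¬pₖ
crossing {suc k} {P} P? mono p₀ ¬pₖ with P? (suc zero)
... | no ¬p₁ = zero , p₀ , ¬p₁ , λ
  { zero    0≢0 → contradiction refl 0≢0
  ; (suc j) _   → inj₂ (¬p₁ ∘ downward (P ∘ suc) (mono ∘ suc) (inject₁ j)) }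
  where
  downward : ∀ {k} (P : Fin (suc k) → Set) → (∀ i → P (suc i) → P (inject₁ i)) → ∀ i → P i → P zero
  downward         P mono zero    p = p
  downward {suc k} P mono (suc i) p = mono zero (downward (P ∘ suc) (mono ∘ suc) i p)
... | yes p₁ with crossing (P? ∘ suc) (mono ∘ suc) p₁ ¬pₖ
... | i , p , ¬p , others = suc i , p , ¬p , λ
  { zero    _   → inj₁ p₁
  ; (suc j) j≢i → others j (j≢i ∘ cong suc) }

T-ext : ∀ {a b} → (T a → T b) → (T b → T a) → a ≡ b
T-ext {true}  {true}  f g = refl
T-ext {true}  {false} f g = ⊥-elim (f tt)
T-ext {false} {true}  f g = ⊥-elim (g tt)
T-ext {false} {false} f g = refl

⌊⌋-cong : {P Q : Set} (P? : Dec P) (Q? : Dec Q) → (P → Q) → (Q → P) → ⌊ P? ⌋ ≡ ⌊ Q? ⌋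
⌊⌋-cong P? Q? f g = T-ext (λ t → fromWitness (f (toWitness {a? = P?} t))) (λ t → fromWitness (g (toWitness {a? = Q?} t)))

⌊⌋-false : {P : Set} (P? : Dec P) → ¬ P → ⌊ P? ⌋ ≡ false
⌊⌋-false (yes p) ¬p = contradiction p ¬p
⌊⌋-false (no _)  _  = refl

⌊⌋-true : {P : Set} (P? : Dec P) → P → ⌊ P? ⌋ ≡ true
⌊⌋-true (yes _) _ = refl
⌊⌋-true (no ¬p) p = contradiction p ¬p

selfDualCode? : ∀ {n} (G : Perm n → Bool) → Dec (Σ (Code n) λ C → SelfDualCode C × (G ≤Aut C))
selfDualCode? {n} G = code-search n
  (λ C C′ e (sd , aut) →
    (λ v → mk⇔ (λ v∈C′ c c∈C′ → to (sd v) (subst T (sym (e v)) v∈C′) c (subst T (sym (e c)) c∈C′))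
               (λ v⊥ → subst T (e v) (from (sd v) λ c c∈C → v⊥ c (subst T (e c) c∈C)))) ,
    λ p g v → trans (sym (e (v ·P p))) (trans (aut p g v) (e v)))
  λ C → all? vec₂-searchable (λ v → ⇔? (T? (C v)) (all? vec₂-searchable λ c → T? (C c) →-dec (dot v c Bool.≟ false)))
    ×-dec all? perm-searchable (λ p → T? (G p) →-dec all? vec₂-searchable λ v → C (v ·P p) Bool.≟ C v)
  where
  ⇔? : {P Q : Set} → Dec P → Dec Q → Dec (P ⇔ Q)
  ⇔? P? Q? = map′ (λ (f , g) → mk⇔ f g) (λ e → to e , from e) ((P? →-dec Q?) ×-dec (Q? →-dec P?))

-- Permutations of coordinates

module XorSum = Sum (CommutativeRing.+-commutativeMonoid xor-∧-commutativeRing)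

∘P-assoc : ∀ {n} (p q r : Perm n) → (p ∘P q) ∘P r ≡ p ∘P (q ∘P r)
∘P-assoc p q r = tabulate-cong λ i → begin
  lookup (p ∘P q) (lookup r i)       ≡⟨ lookup∘tabulate _ (lookup r i) ⟩
  lookup p (lookup q (lookup r i))   ≡⟨ cong (lookup p) (lookup∘tabulate _ i) ⟨
  lookup p (lookup (q ∘P r) i)       ∎

∘P-identityʳ : ∀ {n} (p : Perm n) → p ∘P idP ≡ p
∘P-identityʳ p = trans (tabulate-cong λ i → cong (lookup p) (lookup-allFin i)) (tabulate∘lookup p)

∘P-identityˡ : ∀ {n} (p : Perm n) → idP ∘P p ≡ p
∘P-identityˡ p = trans (tabulate-cong λ i → lookup-allFin (lookup p i)) (tabulate∘lookup p)

·P-identity : ∀ {n} (v : Vec₂ n) → v ·P idP ≡ v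
·P-identity v = trans (tabulate-cong λ i → cong (lookup v) (lookup-allFin i)) (tabulate∘lookup v)

·P-∘P : ∀ {n} (v : Vec₂ n) p q → v ·P (p ∘P q) ≡ (v ·P p) ·P q
·P-∘P v p q = tabulate-cong λ i → begin
  lookup v (lookup (p ∘P q) i)      ≡⟨ cong (lookup v) (lookup∘tabulate _ i) ⟩
  lookup v (lookup p (lookup q i))  ≡⟨ lookup∘tabulate _ (lookup q i) ⟨
  lookup (v ·P p) (lookup q i)      ∎

·P-⊕ : ∀ {n} (p : Perm n) → Additive (_·P p)
·P-⊕ p u v = begin
  tabulate (λ i → lookup (u ⊕ v) (lookup p i))                ≡⟨ tabulate-cong (λ i → lookup-zipWith _xor_ (lookup p i) u v) ⟩
  tabulate (λ i → lookup u (lookup p i) xor lookup v (lookup p i)) ≡⟨ tabulate-⊕ _ _ ⟩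
  (u ·P p) ⊕ (v ·P p)                                         ∎
  where
  tabulate-⊕ : ∀ {m} (f g : Fin m → Bool) → tabulate (λ i → f i xor g i) ≡ tabulate f ⊕ tabulate g
  tabulate-⊕ {zero}  f g = refl
  tabulate-⊕ {suc m} f g = cong ((f zero xor g zero) ∷_) (tabulate-⊕ (f ∘ suc) (g ∘ suc))

-- As a sum in the monoid of `xor`, `dot` inherits invariance under reindexing.
dot≡sum : ∀ {n} (u v : Vec₂ n) → dot u v ≡ XorSum.sum (λ i → lookup u i ∧ lookup v i)
dot≡sum []      []      = refl
dot≡sum (a ∷ u) (b ∷ v) = cong ((a ∧ b) xor_) (dot≡sum u v)

lookup-inverse : ∀ {n} (p q : Perm n) → p ∘P q ≡ idP → ∀ i → lookup p (lookup q i) ≡ i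
lookup-inverse p q pq i = begin
  lookup p (lookup q i)  ≡⟨ lookup∘tabulate _ i ⟨
  lookup (p ∘P q) i      ≡⟨ cong (λ r → lookup r i) pq ⟩
  lookup idP i           ≡⟨ lookup-allFin i ⟩
  i                      ∎

dot-·P : ∀ {n} (p q : Perm n) → p ∘P q ≡ idP → q ∘P p ≡ idP → ∀ u v → dot (u ·P p) (v ·P p) ≡ dot u v
dot-·P p q pq qp u v = begin
  dot (u ·P p) (v ·P p)                              ≡⟨ dot≡sum (u ·P p) (v ·P p) ⟩
  XorSum.sum (λ i → lookup (u ·P p) i ∧ lookup (v ·P p) i)
    ≡⟨ XorSum.sum-cong-≗ {x = λ i → lookup (u ·P p) i ∧ lookup (v ·P p) i}
         (λ i → cong₂ _∧_ (lookup∘tabulate (lookup u ∘ lookup p) i) (lookup∘tabulate (lookup v ∘ lookup p) i)) ⟩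
  XorSum.sum (λ i → lookup u (lookup p i) ∧ lookup v (lookup p i))
    ≡⟨ XorSum.sum-permute (λ i → lookup u i ∧ lookup v i)
         (Permutation.permutation (lookup p) (lookup q) (lookup-inverse p q pq) (lookup-inverse q p qp)) ⟨
  XorSum.sum (λ i → lookup u i ∧ lookup v i)         ≡⟨ dot≡sum u v ⟨
  dot u v                                            ∎

-- Submodules of the permutation module

record Submodule {n} (G : Perm n → Bool) : Set₁ where
  field
    space : Subspace n
    ∋·    : ∀ {v} p → T (G p) → Mem space v → Mem space (v ·P p)

open Submodule

module PermutationModule {n : ℕ} {G : Perm n → Bool} (isG : IsSubgroup G) where
  open IsSubgroup isG

  infix 4 _∈_ _⊑_ _⋖_
  infixl 6 _⊞_
  infixl 7 _∩_

  _∈_ : Vec₂ n → Submodule G → Set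
  v ∈ U = Mem (space U) v

  _∈?_ : ∀ v U → Dec (v ∈ U)
  v ∈? U = mem? (space U) v

  _⊑_ : Submodule G → Submodule G → Set
  U ⊑ W = ∀ v → v ∈ U → v ∈ W

  ⊑-or-witness : ∀ U W → U ⊑ W ⊎ Σ (Vec₂ n) λ v → v ∈ U × ¬ v ∈ W
  ⊑-or-witness U W with vec₂-searchable (λ v → (v ∈? U) ×-dec ¬? (v ∈? W))
  ... | yes w = inj₂ w
  ... | no ∄w = inj₁ λ v v∈U → decidable-stable (v ∈? W) λ v∉W → ∄w (v , v∈U , v∉W)

  card-⊏ : ∀ U W → U ⊑ W → ∀ v → v ∈ W → ¬ v ∈ U → card (mem? (space U)) < card (mem? (space W))
  card-⊏ U W U⊑W v v∈W v∉U = card-strict (mem? (space U)) (mem? (space W)) U⊑W v v∉U v∈W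

  cocard-⊏ : ∀ U W → U ⊑ W → ∀ v → v ∈ W → ¬ v ∈ U →
             card (¬? ∘ mem? (space W)) < card (¬? ∘ mem? (space U))
  cocard-⊏ U W U⊑W v v∈W v∉U =
    card-strict (¬? ∘ mem? (space W)) (¬? ∘ mem? (space U)) (λ w w∉W → w∉W ∘ U⊑W w) v (_$ v∈W) v∉U

  -- `inv∈` supplies right inverses only. As in any monoid, the left inverse `p` of `q` agrees with
  -- a right inverse of `q`.
  inverse-comm : ∀ p q → T (G p) → T (G q) → p ∘P q ≡ idP → q ∘P p ≡ idP
  inverse-comm p q gp gq pq with inv∈ q gq
  ... | r , _ , qr = subst (λ x → q ∘P x ≡ idP) (sym p≡r) qr
    where
    p≡r : p ≡ r
    p≡r = begin
      p                ≡⟨ ∘P-identityʳ p ⟨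
      p ∘P idP         ≡⟨ cong (p ∘P_) qr ⟨
      p ∘P (q ∘P r)    ≡⟨ ∘P-assoc p q r ⟨
      (p ∘P q) ∘P r    ≡⟨ cong (_∘P r) pq ⟩
      idP ∘P r         ≡⟨ ∘P-identityˡ r ⟩
      r                ∎

  dot-adjoint : ∀ p q → T (G p) → T (G q) → p ∘P q ≡ idP → ∀ u v → dot (u ·P p) v ≡ dot u (v ·P q)
  dot-adjoint p q gp gq pq u v = begin
    dot (u ·P p) v                   ≡⟨ cong (dot (u ·P p)) (·P-identity v) ⟨
    dot (u ·P p) (v ·P idP)          ≡⟨ cong (λ r → dot (u ·P p) (v ·P r)) qp ⟨
    dot (u ·P p) (v ·P (q ∘P p))     ≡⟨ cong (dot (u ·P p)) (·P-∘P v q p) ⟩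
    dot (u ·P p) ((v ·P q) ·P p)     ≡⟨ dot-·P p q pq qp u (v ·P q) ⟩
    dot u (v ·P q)                   ∎
    where qp = inverse-comm p q gp gq pq

  ⊤ₛ : Submodule G
  ⊤ₛ = record
    { space = record { Mem = λ _ → Data.Unit.⊤ ; mem? = λ _ → yes tt ; ∋0 = tt ; ∋⊕ = λ _ _ → tt }
    ; ∋· = λ _ _ _ → tt }

  0ₛ : Submodule G
  0ₛ = record
    { space = record { Mem = _≡ 0v ; mem? = _≟ 0v ; ∋0 = refl
                     ; ∋⊕ = λ { refl refl → ⊕-self 0v } }
    ; ∋· = λ { p _ refl → additive-0 (_·P p) (·P-⊕ p) } }

  _∩_ : Submodule G → Submodule G → Submodule G
  U ∩ W = record
    { space = record
      { Mem  = λ v → v ∈ U × v ∈ W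
      ; mem? = λ v → (v ∈? U) ×-dec (v ∈? W)
      ; ∋0   = ∋0 (space U) , ∋0 (space W)
      ; ∋⊕   = λ (p , q) (p′ , q′) → ∋⊕ (space U) p p′ , ∋⊕ (space W) q q′ }
    ; ∋· = λ p g (a , b) → ∋· U p g a , ∋· W p g b }

  -- In characteristic 2 the complementary summand of `v` is `v ⊕ u`, so one witness is enough.
  _⊞_ : Submodule G → Submodule G → Submodule G
  U ⊞ W = record
    { space = record
      { Mem  = λ v → Σ (Vec₂ n) λ u → u ∈ U × (v ⊕ u) ∈ W
      ; mem? = λ v → vec₂-searchable λ u → (u ∈? U) ×-dec ((v ⊕ u) ∈? W)
      ; ∋0   = 0v , ∋0 (space U) , subst (_∈ W) (sym (⊕-self 0v)) (∋0 (space W))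
      ; ∋⊕   = λ {v} {v′} (u , p , q) (u′ , p′ , q′) →
          u ⊕ u′ , ∋⊕ (space U) p p′ , subst (_∈ W) (⊕-interchange v u v′ u′) (∋⊕ (space W) q q′) }
    ; ∋· = λ {v} p g (u , a , b) → u ·P p , ∋· U p g a , subst (_∈ W) (·P-⊕ p v u) (∋· W p g b) }

  infix 8 _^⊥
  _^⊥ : Submodule G → Submodule G
  U ^⊥ = record
    { space = record
      { Mem  = λ v → ∀ u → u ∈ U → dot v u ≡ false
      ; mem? = λ v → all? vec₂-searchable λ u → (u ∈? U) →-dec (dot v u Bool.≟ false)
      ; ∋0   = λ u _ → dot-0ˡ u
      ; ∋⊕   = λ {v} {w} p q u u∈U → trans (dot-⊕ˡ v w u) (cong₂ _xor_ (p u u∈U) (q u u∈U)) }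
    ; ∋· = λ {v} p g v⊥ u u∈U → let (q , gq , pq) = inv∈ p g in
        trans (dot-adjoint p q g gq pq v u) (v⊥ (u ·P q) (∋· U q gq u∈U)) }

  ⊞-left : ∀ U W → U ⊑ U ⊞ W
  ⊞-left U W u u∈U = u , u∈U , subst (_∈ W) (sym (⊕-self u)) (∋0 (space W))

  ⊞-right : ∀ U W → W ⊑ U ⊞ W
  ⊞-right U W w w∈W = 0v , ∋0 (space U) , subst (_∈ W) (sym (⊕-identityʳ w)) w∈W

  ⊞-least : ∀ U W X → U ⊑ X → W ⊑ X → U ⊞ W ⊑ X
  ⊞-least U W X U⊑X W⊑X v (u , u∈U , vu∈W) = ∋-cancelʳ (space X) v u (W⊑X _ vu∈W) (U⊑X u u∈U)

  ⊥⊥⇒∈ : ∀ U v → v ∈ (U ^⊥) ^⊥ → v ∈ U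
  ⊥⊥⇒∈ U v v⊥⊥ = double-perp (space U) v λ y y⊥ → trans (dot-comm y v) (v⊥⊥ y y⊥)

  ⊥-sum : ∀ U W → U ^⊥ ∩ W ^⊥ ⊑ (U ⊞ W) ^⊥
  ⊥-sum U W v (v⊥U , v⊥W) x (u , u∈U , xu∈W) = begin
    dot v x                       ≡⟨ cong (dot v) (⊕-cancelʳ x u) ⟨
    dot v ((x ⊕ u) ⊕ u)           ≡⟨ dot-⊕ʳ≡false v (x ⊕ u) u (v⊥W _ xu∈W) (v⊥U u u∈U) ⟩
    false                         ∎

  record _⋖_ (A B : Submodule G) : Set₁ where
    field
      incl    : A ⊑ B
      new     : Σ (Vec₂ n) λ v → v ∈ B × ¬ v ∈ A
      between : ∀ U → A ⊑ U → U ⊑ B → U ⊑ A ⊎ B ⊑ U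

  open _⋖_

  -- `A ⊞ X` lies between `A` and `B` and is not `A`. This is the form in which simplicity of `B/A`
  -- is mostly used.
  ⋖-sum : ∀ {A B} → A ⋖ B → ∀ X → X ⊑ B → ∀ x → x ∈ X → ¬ x ∈ A → B ⊑ A ⊞ X
  ⋖-sum {A} {B} A⋖B X X⊑B x x∈X x∉A
    with between A⋖B (A ⊞ X) (⊞-left A X) (⊞-least A X B (incl A⋖B) X⊑B)
  ... | inj₁ ≤A = contradiction (≤A x (⊞-right A X x x∈X)) x∉A
  ... | inj₂ ≥B = ≥B

  -- A submodule of least cardinality among those strictly above `A` and inside `Q` covers `A`.
  ⋖-exists : ∀ A Q → A ⊑ Q → ∀ v → v ∈ Q → ¬ v ∈ A → ¬ ¬ Σ (Submodule G) λ B → (A ⋖ B) × (B ⊑ Q)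
  ⋖-exists A Q A⊑Q v v∈Q v∉A κ =
    ¬¬-minimal {P = Above} (λ U → card (mem? (space U))) Q (Level.lift (A⊑Q , (λ _ → id) , v , v∈Q , v∉A))
    λ { (B , Level.lift (A⊑B , B⊑Q , w , w∈B , w∉A) , minimal) → κ (B , record
      { incl = A⊑B
      ; new = w , w∈B , w∉A
      ; between = λ U A⊑U U⊑B → case ⊑-or-witness U A of λ
          { (inj₁ U⊑A) → inj₁ U⊑A
          ; (inj₂ (u , u∈U , u∉A)) → case ⊑-or-witness B U of λ
              { (inj₁ B⊑U) → inj₂ B⊑U
              ; (inj₂ (b , b∈B , b∉U)) → contradiction (card-⊏ U B U⊑B b b∈B b∉U)
                  (minimal U (Level.lift (A⊑U , (λ x → B⊑Q x ∘ U⊑B x) , u , u∈U , u∉A))) } } } , B⊑Q) }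
    where
    Above : Submodule G → Set₁
    Above U = Level.Lift _ (A ⊑ U × U ⊑ Q × Σ (Vec₂ n) λ w → w ∈ U × ¬ w ∈ A)

  -- Sections and their isomorphisms

  -- It copies `FactorIso` clause by clause, so that at consecutive levels of a composition series
  -- the two unfold to the same type.
  QuotientIso : Submodule G → Submodule G → Rep G → Set
  QuotientIso A B S =
    Σ (Vec₂ n → Vec₂ (dim S)) λ f →
      ((u v : Vec₂ n) → u ∈ B → v ∈ B → f (u ⊕ v) ≡ f u ⊕ f v) ×
      ((p : Perm n) (g : T (G p)) (v : Vec₂ n) → v ∈ B → f (v ·P p) ≡ act S p g (f v)) ×
      ((s : Vec₂ (dim S)) → Σ (Vec₂ n) λ v → v ∈ B × f v ≡ s) ×
      ((v : Vec₂ n) → v ∈ B → (f v ≡ 0v) ⇔ v ∈ A)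

  -- Maps between sections are defined through representatives and hence arise as relations. Values
  -- are chosen on `B`, and uniqueness of the value makes the choice additive and equivariant.
  relation→iso : ∀ A B S (R : Vec₂ n → Vec₂ (dim S) → Set) →
    (∀ v → v ∈ B → Σ (Vec₂ (dim S)) (R v)) →
    (∀ v s t → v ∈ B → R v s → R v t → s ≡ t) →
    (∀ u v s t → u ∈ B → v ∈ B → R u s → R v t → R (u ⊕ v) (s ⊕ t)) →
    (∀ p (g : T (G p)) v s → v ∈ B → R v s → R (v ·P p) (act S p g s)) →
    (∀ s → Σ (Vec₂ n) λ v → v ∈ B × R v s) →
    (∀ v → v ∈ B → R v 0v ⇔ v ∈ A) →
    QuotientIso A B S
  relation→iso A B S R total unique R-⊕ R-· onto ker with choose-on (space B) {R} total
  ... | f , R-f = f , f-⊕ , f-· , f-onto , f-ker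
    where
    f-⊕ : ∀ u v → u ∈ B → v ∈ B → f (u ⊕ v) ≡ f u ⊕ f v
    f-⊕ u v u∈B v∈B = unique (u ⊕ v) _ _ uv∈B (R-f _ uv∈B) (R-⊕ u v _ _ u∈B v∈B (R-f u u∈B) (R-f v v∈B))
      where uv∈B = ∋⊕ (space B) u∈B v∈B
    f-· : ∀ p (g : T (G p)) v → v ∈ B → f (v ·P p) ≡ act S p g (f v)
    f-· p g v v∈B = unique (v ·P p) _ _ vp∈B (R-f _ vp∈B) (R-· p g v _ v∈B (R-f v v∈B))
      where vp∈B = ∋· B p g v∈B
    f-onto : ∀ s → Σ (Vec₂ n) λ v → v ∈ B × f v ≡ s
    f-onto s with onto s
    ... | v , v∈B , r = v , v∈B , unique v _ _ v∈B (R-f v v∈B) r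
    f-ker : ∀ v → v ∈ B → (f v ≡ 0v) ⇔ v ∈ A
    f-ker v v∈B = mk⇔ (λ e → to (ker v v∈B) (subst (R v) e (R-f v v∈B)))
                      (λ v∈A → unique v _ _ v∈B (R-f v v∈B) (from (ker v v∈B) v∈A))

  -- Zassenhaus: `A′ ∩ B′` maps onto both `A′/A` and `B′/B`, and the two kernels coincide.
  butterfly : ∀ A A′ B B′ S →
    (∀ x → x ∈ A′ → Σ (Vec₂ n) λ z → z ∈ A′ ∩ B′ × (x ⊕ z) ∈ A) →
    (∀ y → y ∈ B′ → Σ (Vec₂ n) λ z → z ∈ A′ ∩ B′ × (y ⊕ z) ∈ B) →
    (∀ z → z ∈ A′ ∩ B′ → z ∈ A → z ∈ B) →
    (∀ z → z ∈ A′ ∩ B′ → z ∈ B → z ∈ A) →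
    A ⊑ A′ →
    QuotientIso A A′ S → QuotientIso B B′ S
  butterfly A A′ B B′ S A′-split B′-split A⇒B B⇒A A⊑A′ (f , f-⊕ , f-· , f-onto , f-ker) =
    relation→iso B B′ S R
      (λ y y∈B′ → let (z , z∈ , yz∈B) = B′-split y y∈B′ in f z , z , z∈ , yz∈B , refl)
      unique
      (λ { y y′ _ _ _ _ (z , (a , b) , yz , refl) (z′ , (a′ , b′) , yz′ , refl) →
           z ⊕ z′ , (∋⊕ (space A′) a a′ , ∋⊕ (space B′) b b′) ,
           subst (_∈ B) (⊕-interchange y z y′ z′) (∋⊕ (space B) yz yz′) , f-⊕ z z′ a a′ })
      (λ { p g y _ _ (z , (a , b) , yz , refl) →
           z ·P p , (∋· A′ p g a , ∋· B′ p g b) , subst (_∈ B) (·P-⊕ p y z) (∋· B p g yz) , f-· p g z a })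
      onto
      λ y y∈B′ → mk⇔
        (λ { (z , z∈@(a , _) , yz , e) → ∋-cancelʳ (space B) y z yz (A⇒B z z∈ (to (f-ker z a) e)) })
        (λ y∈B → 0v , (∋0 (space A′) , ∋0 (space B′)) , subst (_∈ B) (sym (⊕-identityʳ y)) y∈B ,
                 from (f-ker 0v (∋0 (space A′))) (∋0 (space A)))
    where
    R : Vec₂ n → Vec₂ (dim S) → Set
    R y s = Σ (Vec₂ n) λ z → z ∈ A′ ∩ B′ × (y ⊕ z) ∈ B × f z ≡ s

    unique : ∀ y s t → y ∈ B′ → R y s → R y t → s ≡ t
    unique y _ _ _ (z , (a , b) , yz , refl) (z′ , (a′ , b′) , yz′ , refl) =
      ⊕≡0⇒≡ (f z) (f z′) (trans (sym (f-⊕ z z′ a a′))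
        (from (f-ker _ zz′∈A′) (B⇒A _ (zz′∈A′ , ∋⊕ (space B′) b b′) zz′∈B)))
      where
      zz′∈A′ = ∋⊕ (space A′) a a′
      zz′∈B : (z ⊕ z′) ∈ B
      zz′∈B = subst (_∈ B) (begin
        (y ⊕ z) ⊕ (y ⊕ z′)   ≡⟨ ⊕-interchange y z y z′ ⟩
        (y ⊕ y) ⊕ (z ⊕ z′)   ≡⟨ cong (_⊕ (z ⊕ z′)) (⊕-self y) ⟩
        0v ⊕ (z ⊕ z′)        ≡⟨ ⊕-identityˡ _ ⟩
        z ⊕ z′               ∎) (∋⊕ (space B) yz yz′)

    onto : ∀ s → Σ (Vec₂ n) λ y → y ∈ B′ × R y s
    onto s with f-onto s
    ... | x , x∈A′ , refl with A′-split x x∈A′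
    ... | z , z∈@(a , b) , xz∈A = z , b , z , z∈ , subst (_∈ B) (sym (⊕-self z)) (∋0 (space B)) ,
      sym (⊕≡0⇒≡ (f x) (f z) (trans (sym (f-⊕ x z x∈A′ a)) (from (f-ker _ (A⊑A′ _ xz∈A)) xz∈A)))

  -- A nondegenerate pairing of A′/A with B′/B identifies B′/B with the dual of A′/A; surjectivity
  -- onto a simple S then needs only B′ ⋢ B.
  dual-iso : ∀ A A′ B B′ S → Simple S → SelfDualModule S →
    (∀ y → y ∈ B′ → ∀ x → x ∈ A → dot y x ≡ false) →
    (∀ y → y ∈ B′ → (∀ x → x ∈ A′ → dot y x ≡ false) → y ∈ B) →
    (∀ y → y ∈ B → ∀ x → x ∈ A′ → dot y x ≡ false) →
    (Σ (Vec₂ n) λ y → y ∈ B′ × ¬ y ∈ B) →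
    QuotientIso A A′ S → QuotientIso B B′ S
  dual-iso A A′ B B′ S (_ , S-simple) (φ , φ-⊕ˡ , φ-⊕ʳ , φ-act , φ-inj , φ-onto)
           B′⊥A B′∩A′⊥⇒B B⊥A′ (y₀ , y₀∈B′ , y₀∉B) (f , f-⊕ , f-· , f-onto , f-ker) =
    relation→iso B B′ S R total unique R-⊕ R-· onto
      λ y y∈B′ → mk⇔ (λ r → B′∩A′⊥⇒B y y∈B′ λ x x∈A′ → trans (sym (r x x∈A′)) (φ-0 (f x)))
                     (λ y∈B x x∈A′ → trans (φ-0 (f x)) (sym (B⊥A′ y y∈B x x∈A′)))
    where
    φ-0 : ∀ t → φ 0v t ≡ false
    φ-0 t = functional-0 (λ s → φ s t) (λ u v → φ-⊕ˡ u v t)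

    -- `y` corresponds to the `s` whose functional `φ s` is the one that `dot y` induces on `A′/A`.
    R : Vec₂ n → Vec₂ (dim S) → Set
    R y s = ∀ x → x ∈ A′ → φ s (f x) ≡ dot y x

    R? : ∀ y s → Dec (R y s)
    R? y s = all? vec₂-searchable λ x → (x ∈? A′) →-dec (φ s (f x) Bool.≟ dot y x)

    lift : Vec₂ (dim S) → Vec₂ n
    lift s = proj₁ (f-onto s)

    lift-∈ : ∀ s → lift s ∈ A′
    lift-∈ s = proj₁ (proj₂ (f-onto s))

    f-lift : ∀ s → f (lift s) ≡ s
    f-lift s = proj₂ (proj₂ (f-onto s))

    dot-resp : ∀ y → y ∈ B′ → ∀ x x′ → x ∈ A′ → x′ ∈ A′ → f x ≡ f x′ → dot y x ≡ dot y x′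
    dot-resp y y∈B′ x x′ a a′ e = xor≡false⇒≡ (trans (sym (dot-⊕ʳ y x x′)) (B′⊥A y y∈B′ (x ⊕ x′)
      (to (f-ker _ (∋⊕ (space A′) a a′)) (trans (f-⊕ x x′ a a′) (trans (cong (_⊕ f x′) e) (⊕-self (f x′)))))))

    total : ∀ y → y ∈ B′ → Σ (Vec₂ (dim S)) (R y)
    total y y∈B′ with φ-onto (dot y ∘ lift) (λ t t′ → trans
        (dot-resp y y∈B′ _ _ (lift-∈ (t ⊕ t′)) (∋⊕ (space A′) (lift-∈ t) (lift-∈ t′))
          (trans (f-lift (t ⊕ t′)) (sym (trans (f-⊕ _ _ (lift-∈ t) (lift-∈ t′)) (cong₂ _⊕_ (f-lift t) (f-lift t′))))))
        (dot-⊕ʳ y (lift t) (lift t′)))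
    ... | s , φ-s = s , λ x x∈A′ → trans (φ-s (f x)) (dot-resp y y∈B′ _ _ (lift-∈ (f x)) x∈A′ (f-lift (f x)))

    unique : ∀ y s t → y ∈ B′ → R y s → R y t → s ≡ t
    unique y s t _ r r′ = φ-inj s t λ u → begin
      φ s u            ≡⟨ cong (φ s) (f-lift u) ⟨
      φ s (f (lift u)) ≡⟨ r (lift u) (lift-∈ u) ⟩
      dot y (lift u)   ≡⟨ r′ (lift u) (lift-∈ u) ⟨
      φ t (f (lift u)) ≡⟨ cong (φ t) (f-lift u) ⟩
      φ t u            ∎

    R-⊕ : ∀ y y′ s t → y ∈ B′ → y′ ∈ B′ → R y s → R y′ t → R (y ⊕ y′) (s ⊕ t)
    R-⊕ y y′ s t _ _ r r′ x x∈A′ =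
      trans (φ-⊕ˡ s t (f x)) (trans (cong₂ _xor_ (r x x∈A′) (r′ x x∈A′)) (sym (dot-⊕ˡ y y′ x)))

    R-· : ∀ p (g : T (G p)) y s → y ∈ B′ → R y s → R (y ·P p) (act S p g s)
    R-· p g y s _ r x x∈A′ = let (q , gq , pq) = inv∈ p g in begin
      φ (act S p g s) (f x)    ≡⟨ φ-act p q g gq pq s (f x) ⟩
      φ s (act S q gq (f x))   ≡⟨ cong (φ s) (f-· q gq x x∈A′) ⟨
      φ s (f (x ·P q))         ≡⟨ r (x ·P q) (∋· A′ q gq x∈A′) ⟩
      dot y (x ·P q)           ≡⟨ dot-adjoint p q g gq pq y x ⟨
      dot (y ·P p) x           ∎

    Image : Vec₂ (dim S) → Set
    Image s = Σ (Vec₂ n) λ y → y ∈ B′ × R y s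

    image? : ∀ s → Dec (Image s)
    image? s = vec₂-searchable λ y → (y ∈? B′) ×-dec R? y s

    image-isSubmodule : IsSubmodule G (dim S) (act S) (λ s → ⌊ image? s ⌋)
    image-isSubmodule =
      fromWitness (0v , ∋0 (space B′) , λ x _ → trans (φ-0 (f x)) (sym (dot-0ˡ x))) ,
      (λ s t i j → let (y , b , r) = toWitness {a? = image? s} i ; (y′ , b′ , r′) = toWitness {a? = image? t} j in
        fromWitness (y ⊕ y′ , ∋⊕ (space B′) b b′ , R-⊕ y y′ s t b b′ r r′)) ,
      λ p g s i → let (y , b , r) = toWitness {a? = image? s} i in
        fromWitness (y ·P p , ∋· B′ p g b , R-· p g y s b r)

    onto : ∀ s → Image s
    onto s with S-simple (λ s → ⌊ image? s ⌋) image-isSubmodule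
    ... | inj₂ all = toWitness {a? = image? s} (all s)
    ... | inj₁ ≡0 = let (s₀ , r) = total y₀ y₀∈B′ in contradiction
      (B′∩A′⊥⇒B y₀ y₀∈B′ λ x x∈A′ → trans (sym (r x x∈A′))
        (trans (cong (λ s → φ s (f x)) (≡0 s₀ (fromWitness (y₀ , y₀∈B′ , r)))) (φ-0 (f x)))) y₀∉B

  module QuotientModule {C D : Submodule G} (C⋖D : C ⋖ D) where
    open Coordinates (coordinates (space C) (space D) (incl C⋖D)) renaming (rank to d)

    lift : Vec₂ d → Vec₂ n
    lift s = proj₁ (coord-onto s)

    lift-∈ : ∀ s → lift s ∈ D
    lift-∈ s = proj₁ (proj₂ (coord-onto s))

    coord-lift : ∀ s → coord (lift s) ≡ s
    coord-lift s = proj₂ (proj₂ (coord-onto s))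

    -- The action on `D/C` goes through chosen lifts. Two lifts differ by an element of `C`, and `C`
    -- is invariant, so the choice does not matter.
    coord-·-cong : ∀ p → T (G p) → ∀ x y → x ∈ D → y ∈ D → coord x ≡ coord y → coord (x ·P p) ≡ coord (y ·P p)
    coord-·-cong p g x y x∈D y∈D e = ⊕≡0⇒≡ _ _ (begin
      coord (x ·P p) ⊕ coord (y ·P p)   ≡⟨ coord-⊕ _ _ ⟨
      coord ((x ·P p) ⊕ (y ·P p))       ≡⟨ cong coord (·P-⊕ p x y) ⟨
      coord ((x ⊕ y) ·P p)              ≡⟨ kernel⇐ _ (∋· C p g xy∈C) ⟩
      0v                                ∎)
      where
      xy∈C : (x ⊕ y) ∈ C
      xy∈C = kernel⇒ _ (∋⊕ (space D) x∈D y∈D) (trans (coord-⊕ x y) (trans (cong (_⊕ coord y) e) (⊕-self _)))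

    rep : Rep G
    rep = record
      { dim = d
      ; act = λ p _ s → coord (lift s ·P p)
      ; act-⊕ = λ p g s t → begin
          coord (lift (s ⊕ t) ·P p)
            ≡⟨ coord-·-cong p g _ _ (lift-∈ _) (∋⊕ (space D) (lift-∈ s) (lift-∈ t))
                 (trans (coord-lift _) (sym (trans (coord-⊕ _ _) (cong₂ _⊕_ (coord-lift s) (coord-lift t))))) ⟩
          coord ((lift s ⊕ lift t) ·P p)
            ≡⟨ cong coord (·P-⊕ p (lift s) (lift t)) ⟩
          coord ((lift s ·P p) ⊕ (lift t ·P p))
            ≡⟨ coord-⊕ _ _ ⟩
          coord (lift s ·P p) ⊕ coord (lift t ·P p) ∎
      ; act-id = λ _ s → trans (cong coord (·P-identity (lift s))) (coord-lift s)
      ; act-∘ = λ p q gp gq _ s → trans (cong coord (·P-∘P (lift s) p q))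
          (coord-·-cong q gq _ _ (∋· D p gp (lift-∈ s)) (lift-∈ _) (sym (coord-lift _))) }

    iso : QuotientIso C D rep
    iso = coord , (λ u v _ _ → coord-⊕ u v) ,
      (λ p g v v∈D → coord-·-cong p g v _ v∈D (lift-∈ _) (sym (coord-lift _))) ,
      coord-onto , λ v v∈D → mk⇔ (kernel⇒ v v∈D) (kernel⇐ v)

    simple : Simple rep
    simple = positive , irreducible
      where
      positive : 1 ≤ d
      positive with new C⋖D
      ... | v , v∈D , v∉C = ℕ.≰⇒> λ d≤0 → v∉C (kernel⇒ v v∈D (trivial d≤0 (coord v)))
        where
        trivial : ∀ {e} → e ≤ 0 → (s : Vec₂ e) → s ≡ 0v
        trivial z≤n [] = refl

      irreducible : (W : Vec₂ d → Bool) → IsSubmodule G d (act rep) W →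
        ((s : Vec₂ d) → T (W s) → s ≡ 0v) ⊎ ((s : Vec₂ d) → T (W s))
      irreducible W (W-0 , W-⊕ , W-·) with between C⋖D U
          (λ v v∈C → incl C⋖D v v∈C , subst (T ∘ W) (sym (kernel⇐ v v∈C)) W-0) (λ _ → proj₁)
        where
        U : Submodule G
        U = record
          { space = record
            { Mem  = λ v → v ∈ D × T (W (coord v))
            ; mem? = λ v → (v ∈? D) ×-dec T? (W (coord v))
            ; ∋0   = ∋0 (space D) , subst (T ∘ W) (sym (additive-0 coord coord-⊕)) W-0
            ; ∋⊕   = λ {u} {v} (a , p) (b , q) →
                ∋⊕ (space D) a b , subst (T ∘ W) (sym (coord-⊕ u v)) (W-⊕ _ _ p q) }
          ; ∋· = λ {v} p g (a , w) → ∋· D p g a ,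
              subst (T ∘ W) (coord-·-cong p g _ v (lift-∈ _) a (coord-lift _)) (W-· p g _ w) }
      ... | inj₁ U⊑C = inj₁ λ s s∈W → trans (sym (coord-lift s))
              (kernel⇐ _ (U⊑C (lift s) (lift-∈ s , subst (T ∘ W) (sym (coord-lift s)) s∈W)))
      ... | inj₂ D⊑U = inj₂ λ s → subst (T ∘ W) (coord-lift s) (proj₂ (D⊑U (lift s) (lift-∈ s)))

  -- Invariant symmetric forms

  record InvariantForm (S : Rep G) : Set where
    field
      form      : Vec₂ (dim S) → Vec₂ (dim S) → Bool
      form-⊕ˡ   : ∀ s t u → form (s ⊕ t) u ≡ form s u xor form t u
      form-comm : ∀ s t → form s t ≡ form t s
      form-act  : ∀ p q (gp : T (G p)) (gq : T (G q)) → p ∘P q ≡ idP →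
                  ∀ s t → form (act S p gp s) t ≡ form s (act S q gq t)
      nondegenerate : ∀ s → (∀ t → form s t ≡ false) → s ≡ 0v

    form-⊕ʳ : ∀ s → Functional (form s)
    form-⊕ʳ s t u = trans (form-comm s (t ⊕ u)) (trans (form-⊕ˡ t u s) (cong₂ _xor_ (form-comm t s) (form-comm u s)))

    form-injective : ∀ s t → (∀ u → form s u ≡ form t u) → s ≡ t
    form-injective s t e = ⊕≡0⇒≡ s t (nondegenerate (s ⊕ t) λ u →
      trans (form-⊕ˡ s t u) (trans (cong (_xor form t u) (e u)) (xor-same (form t u))))

    -- Nondegeneracy gives injectivity of S → S*; surjectivity follows by duality. Functionals are
    -- turned into vectors through `dot`; a vector orthogonal to the whole image lies in the radical
    -- of the form, so it is zero, and `double-perp` shows that the image is everything.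
    representable : (h : Vec₂ (dim S) → Bool) → Functional h → Σ (Vec₂ (dim S)) λ s → ∀ t → form s t ≡ h t
    representable h h-⊕ = map₂ (λ e t → trans (e t) (y-h t)) (double-perp Image y y⊥⊥)
      where
      y   = proj₁ (dot-representable h h-⊕)
      y-h = proj₂ (dot-representable h h-⊕)

      Image : Subspace (dim S)
      Image = record
        { Mem  = λ v → Σ (Vec₂ (dim S)) λ s → ∀ t → form s t ≡ dot v t
        ; mem? = λ v → vec₂-searchable λ s → all? vec₂-searchable λ t → form s t Bool.≟ dot v t
        ; ∋0   = 0v , λ t → trans (functional-0 (λ s → form s t) (λ u v → form-⊕ˡ u v t)) (sym (dot-0ˡ t))
        ; ∋⊕   = λ {u} {v} (s , p) (s′ , q) → s ⊕ s′ , λ t →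
            trans (form-⊕ˡ s s′ t) (trans (cong₂ _xor_ (p t) (q t)) (sym (dot-⊕ˡ u v t))) }

      y⊥⊥ : ∀ x → (∀ v → Mem Image v → dot x v ≡ false) → dot x y ≡ false
      y⊥⊥ x x⊥ = trans (cong (λ z → dot z y) x≡0) (dot-0ˡ y)
        where
        x≡0 : x ≡ 0v
        x≡0 = nondegenerate x λ t → let (v , v-t) = dot-representable (form t) (form-⊕ʳ t) in begin
          form x t   ≡⟨ form-comm x t ⟩
          form t x   ≡⟨ v-t x ⟨
          dot v x    ≡⟨ dot-comm v x ⟩
          dot x v    ≡⟨ x⊥ v (t , λ u → sym (v-t u)) ⟩
          false      ∎

    selfDual : SelfDualModule S
    selfDual = form , form-⊕ˡ , form-⊕ʳ , form-act , form-injective , representable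

  open InvariantForm

  -- `dot` on `D` descends to `D/C` because `D` is orthogonal to `C`, and it is nondegenerate there
  -- because its radical `D ∩ D ^⊥` lies in `C`.
  section-form : ∀ C D S → C ⊑ D → D ⊑ C ^⊥ → D ∩ D ^⊥ ⊑ C → ((f , _) : QuotientIso C D S) →
    Σ (InvariantForm S) λ β → ∀ x y → x ∈ D → y ∈ D → form β (f x) (f y) ≡ dot x y
  section-form C D S C⊑D D⊑C⊥ D∩D⊥⊑C (f , f-⊕ , f-· , f-onto , f-ker) =
    record
      { form = b
      ; form-⊕ˡ = λ s t u → trans
          (lift-unique (lift s ⊕ lift t) (s ⊕ t) (lift u) (∋⊕ (space D) (lift-∈ s) (lift-∈ t))
            (trans (f-⊕ _ _ (lift-∈ s) (lift-∈ t)) (cong₂ _⊕_ (f-lift s) (f-lift t))) (lift-∈ u))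
          (dot-⊕ˡ (lift s) (lift t) (lift u))
      ; form-comm = λ s t → dot-comm (lift s) (lift t)
      ; form-act = λ p q gp gq pq s t → begin
          dot (lift (act S p gp s)) (lift t)
            ≡⟨ lift-unique (lift s ·P p) _ _ (∋· D p gp (lift-∈ s)) (f-act p gp s) (lift-∈ t) ⟩
          dot (lift s ·P p) (lift t)
            ≡⟨ dot-adjoint p q gp gq pq (lift s) (lift t) ⟩
          dot (lift s) (lift t ·P q)
            ≡⟨ dot-comm (lift s) (lift t ·P q) ⟩
          dot (lift t ·P q) (lift s)
            ≡⟨ lift-unique (lift t ·P q) _ _ (∋· D q gq (lift-∈ t)) (f-act q gq t) (lift-∈ s) ⟨
          dot (lift (act S q gq t)) (lift s)
            ≡⟨ dot-comm (lift (act S q gq t)) (lift s) ⟩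
          dot (lift s) (lift (act S q gq t)) ∎
      ; nondegenerate = λ s s⊥ → trans (sym (f-lift s)) (from (f-ker (lift s) (lift-∈ s))
          (D∩D⊥⊑C (lift s) (lift-∈ s , λ x x∈D → begin
            dot (lift s) x              ≡⟨ dot-comm (lift s) x ⟩
            dot x (lift s)              ≡⟨ lift-unique x (f x) (lift s) x∈D refl (lift-∈ s) ⟨
            dot (lift (f x)) (lift s)   ≡⟨ dot-comm (lift (f x)) (lift s) ⟩
            dot (lift s) (lift (f x))   ≡⟨ s⊥ (f x) ⟩
            false                       ∎))) } ,
    λ x y x∈D y∈D → begin
      dot (lift (f x)) (lift (f y))  ≡⟨ lift-unique x (f x) _ x∈D refl (lift-∈ _) ⟩
      dot x (lift (f y))             ≡⟨ dot-comm x (lift (f y)) ⟩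
      dot (lift (f y)) x             ≡⟨ lift-unique y (f y) x y∈D refl x∈D ⟩
      dot y x                        ≡⟨ dot-comm y x ⟩
      dot x y                        ∎
    where
    lift : Vec₂ (dim S) → Vec₂ n
    lift s = proj₁ (f-onto s)

    lift-∈ : ∀ s → lift s ∈ D
    lift-∈ s = proj₁ (proj₂ (f-onto s))

    f-lift : ∀ s → f (lift s) ≡ s
    f-lift s = proj₂ (proj₂ (f-onto s))

    f-act : ∀ p g s → f (lift s ·P p) ≡ act S p g s
    f-act p g s = trans (f-· p g (lift s) (lift-∈ s)) (cong (act S p g) (f-lift s))

    b : Vec₂ (dim S) → Vec₂ (dim S) → Bool
    b s t = dot (lift s) (lift t)

    lift-unique : ∀ x s z → x ∈ D → f x ≡ s → z ∈ D → dot (lift s) z ≡ dot x z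
    lift-unique x s z x∈D e z∈D = xor≡false⇒≡ (begin
      dot (lift s) z xor dot x z  ≡⟨ dot-⊕ˡ (lift s) x z ⟨
      dot (lift s ⊕ x) z          ≡⟨ dot-comm _ z ⟩
      dot z (lift s ⊕ x)          ≡⟨ D⊑C⊥ z z∈D _ (to (f-ker _ (∋⊕ (space D) (lift-∈ s) x∈D))
                                       (trans (f-⊕ _ _ (lift-∈ s) x∈D) (trans (cong₂ _⊕_ (f-lift s) e) (⊕-self s)))) ⟩
      false                       ∎)

  -- Automorphisms of a simple module and isometries of its forms

  Equivariant : (S : Rep G) → (Vec₂ (dim S) → Vec₂ (dim S)) → Set
  Equivariant S α = ∀ p (g : T (G p)) s → α (act S p g s) ≡ act S p g (α s)

  -- Schur's argument: the fixed points of `α` form a submodule, which is not zero.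
  fixed-nonzero⇒identity : ∀ S → Simple S → ∀ α → Additive α → Equivariant S α →
    ∀ s₀ → s₀ ≢ 0v → α s₀ ≡ s₀ → ∀ s → α s ≡ s
  fixed-nonzero⇒identity S (_ , irreducible) α α-⊕ α-· s₀ s₀≢0 α-s₀ s
    with irreducible (λ t → ⌊ α t ≟ t ⌋)
      ( fromWitness (additive-0 α α-⊕)
      , (λ u v i j → fromWitness (trans (α-⊕ u v)
          (cong₂ _⊕_ (toWitness {a? = α u ≟ u} i) (toWitness {a? = α v ≟ v} j))))
      , λ p g v i → fromWitness (trans (α-· p g v) (cong (act S p g) (toWitness {a? = α v ≟ v} i))))
  ... | inj₁ ≡0  = contradiction (≡0 s₀ (fromWitness α-s₀)) s₀≢0
  ... | inj₂ all = toWitness {a? = α s ≟ s} (all s)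

  -- α² = 1 means (α + 1)² = 0 in characteristic 2, and α + 1 maps into the fixed points of α.
  involution⇒identity : ∀ S → Simple S → ∀ α → Additive α → Equivariant S α →
    (∀ s → α (α s) ≡ s) → ∀ s → α s ≡ s
  involution⇒identity S S-simple α α-⊕ α-· α² s with (α s ⊕ s) ≟ 0v
  ... | yes e = ⊕≡0⇒≡ (α s) s e
  ... | no ≢0 = fixed-nonzero⇒identity S S-simple α α-⊕ α-· (α s ⊕ s) ≢0 (begin
    α (α s ⊕ s)       ≡⟨ α-⊕ (α s) s ⟩
    α (α s) ⊕ α s     ≡⟨ cong (_⊕ α s) (α² s) ⟩
    s ⊕ α s           ≡⟨ ⊕-comm s (α s) ⟩
    α s ⊕ s           ∎) s

  iterate-⊕ : ∀ {d} (α : Vec₂ d → Vec₂ d) → Additive α → ∀ k → Additive (λ s → fold s α k)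
  iterate-⊕ α α-⊕ zero    s t = refl
  iterate-⊕ α α-⊕ (suc k) s t = trans (cong α (iterate-⊕ α α-⊕ k s t)) (α-⊕ _ _)

  iterate-· : ∀ S α → Equivariant S α → ∀ k → Equivariant S (λ s → fold s α k)
  iterate-· S α α-· zero    p g s = refl
  iterate-· S α α-· (suc k) p g s = trans (cong α (iterate-· S α α-· k p g s)) (α-· p g _)

  iterate-injective : ∀ {d} (α : Vec₂ d → Vec₂ d) → (∀ s t → α s ≡ α t → s ≡ t) →
    ∀ k s t → fold s α k ≡ fold t α k → s ≡ t
  iterate-injective α α-inj zero    s t e = e
  iterate-injective α α-inj (suc k) s t e = iterate-injective α α-inj k s t (α-inj _ _ e)

  bit : Bool → Fin 2
  bit true  = suc zero
  bit false = zero

  bit-injective : ∀ a b → bit a ≡ bit b → a ≡ b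
  bit-injective true  true  _ = refl
  bit-injective false false _ = refl

  encode : ∀ {d} → Vec₂ d → Fin (2 ^ d)
  encode []      = zero
  encode (a ∷ v) = combine (bit a) (encode v)

  encode-injective : ∀ {d} (u v : Vec₂ d) → encode u ≡ encode v → u ≡ v
  encode-injective []      []      _ = refl
  encode-injective (a ∷ u) (b ∷ v) e =
    let (a≡b , u≡v) = combine-injective (bit a) (encode u) (bit b) (encode v) e in
    cong₂ _∷_ (bit-injective a b a≡b) (encode-injective u v u≡v)

  -- Two of the first 2^d + 1 iterates of `s` coincide, and injectivity cancels the smaller
  -- exponent.
  periodic : ∀ {d} (α : Vec₂ d → Vec₂ d) → (∀ s t → α s ≡ α t → s ≡ t) →
    ∀ s → Σ ℕ λ m → 1 ≤ m × fold s α m ≡ s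
  periodic {d} α α-inj s with pigeonhole (ℕ.n<1+n (2 ^ d)) (λ i → encode (fold s α (Fin.toℕ i)))
  ... | i , j , i<j , e = Fin.toℕ j ∸ Fin.toℕ i , ℕ.m<n⇒0<n∸m i<j ,
    iterate-injective α α-inj (Fin.toℕ i) _ s (begin
      fold (fold s α (Fin.toℕ j ∸ Fin.toℕ i)) α (Fin.toℕ i)  ≡⟨ fold-+ s α (Fin.toℕ i) ⟨
      fold s α (Fin.toℕ i + (Fin.toℕ j ∸ Fin.toℕ i))         ≡⟨ cong (fold s α) (ℕ.m+[n∸m]≡n (ℕ.<⇒≤ i<j)) ⟩
      fold s α (Fin.toℕ j)                                   ≡⟨ encode-injective _ _ e ⟨
      fold s α (Fin.toℕ i)                                   ∎)

  halve : ∀ m → Σ ℕ λ k → m ≡ k + k ⊎ m ≡ suc (k + k)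
  halve zero    = 0 , inj₁ refl
  halve (suc m) with halve m
  ... | k , inj₁ refl = k , inj₂ refl
  ... | k , inj₂ refl = suc k , inj₁ (cong suc (sym (ℕ.+-suc k k)))

  -- A period `m` of one nonzero vector is already an exponent of `α`, since α^m fixes that vector.
  -- While `m` is even, α^(m/2) is an involution, hence trivial, and `m` can be halved.
  odd-order : ∀ S → Simple S → ∀ α → Additive α → Equivariant S α → (∀ s t → α s ≡ α t → s ≡ t) →
    Σ ℕ λ k → ∀ s → fold s α (suc (k + k)) ≡ s
  odd-order S S-simple α α-⊕ α-· α-inj = reduce m (<-wellFounded m) 1≤m
    (fixed-nonzero⇒identity S S-simple _ (iterate-⊕ α α-⊕ m) (iterate-· S α α-· m) s₀ s₀≢0 α-s₀)
    where
    nonzero : ∀ {d} → 1 ≤ d → Σ (Vec₂ d) (_≢ 0v)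
    nonzero (s≤s _) = true ∷ 0v , λ ()

    s₀   = proj₁ (nonzero (proj₁ S-simple))
    s₀≢0 = proj₂ (nonzero (proj₁ S-simple))
    m    = proj₁ (periodic α α-inj s₀)
    1≤m  = proj₁ (proj₂ (periodic α α-inj s₀))
    α-s₀ = proj₂ (proj₂ (periodic α α-inj s₀))

    reduce : ∀ m → Acc _<_ m → 1 ≤ m → (∀ s → fold s α m ≡ s) → Σ ℕ λ k → ∀ s → fold s α (suc (k + k)) ≡ s
    reduce m (acc rs) 1≤m αᵐ with halve m
    ... | k     , inj₂ refl = k , αᵐ
    ... | suc k , inj₁ refl = reduce (suc k) (rs (s≤s (ℕ.m≤n+m (suc k) k))) (s≤s z≤n)
      (involution⇒identity S S-simple _ (iterate-⊕ α α-⊕ (suc k)) (iterate-· S α α-· (suc k))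
        λ s → trans (sym (fold-+ s α (suc k))) (αᵐ s))
    reduce .0 _ () _ | zero , inj₁ refl

  form-quotient : ∀ S → (β β′ : InvariantForm S) →
    Σ (Vec₂ (dim S) → Vec₂ (dim S)) λ α → ∀ s t → form β (α s) t ≡ form β′ s t
  form-quotient S β β′ = (λ s → proj₁ (rep s)) , λ s → proj₂ (rep s)
    where
    rep : ∀ s → Σ (Vec₂ (dim S)) λ r → ∀ t → form β r t ≡ form β′ s t
    rep s = representable β (form β′ s) (form-⊕ʳ β′ s)

  module FormQuotient (S : Rep G) (β β′ : InvariantForm S) (α : Vec₂ (dim S) → Vec₂ (dim S))
                      (α-form : ∀ s t → form β (α s) t ≡ form β′ s t) where
    α-⊕ : Additive α
    α-⊕ s t = form-injective β _ _ λ u → begin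
      form β (α (s ⊕ t)) u                    ≡⟨ α-form (s ⊕ t) u ⟩
      form β′ (s ⊕ t) u                       ≡⟨ form-⊕ˡ β′ s t u ⟩
      form β′ s u xor form β′ t u             ≡⟨ cong₂ _xor_ (α-form s u) (α-form t u) ⟨
      form β (α s) u xor form β (α t) u       ≡⟨ form-⊕ˡ β (α s) (α t) u ⟨
      form β (α s ⊕ α t) u                    ∎

    α-· : Equivariant S α
    α-· p g s = form-injective β _ _ λ u → let (q , gq , pq) = inv∈ p g in begin
      form β (α (act S p g s)) u              ≡⟨ α-form (act S p g s) u ⟩
      form β′ (act S p g s) u                 ≡⟨ form-act β′ p q g gq pq s u ⟩
      form β′ s (act S q gq u)                ≡⟨ α-form s (act S q gq u) ⟨
      form β (α s) (act S q gq u)             ≡⟨ form-act β p q g gq pq (α s) u ⟨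
      form β (act S p g (α s)) u              ∎

    α-injective : ∀ s t → α s ≡ α t → s ≡ t
    α-injective s t e = form-injective β′ s t λ u →
      trans (sym (α-form s u)) (trans (cong (λ v → form β v u) e) (α-form t u))

    α-adjoint : ∀ s t → form β (α s) t ≡ form β s (α t)
    α-adjoint s t = begin
      form β (α s) t     ≡⟨ α-form s t ⟩
      form β′ s t        ≡⟨ form-comm β′ s t ⟩
      form β′ t s        ≡⟨ α-form t s ⟨
      form β (α t) s     ≡⟨ form-comm β (α t) s ⟩
      form β s (α t)     ∎

    iterate-adjoint : ∀ k s t → form β (fold s α k) t ≡ form β s (fold t α k)
    iterate-adjoint zero    s t = refl
    iterate-adjoint (suc k) s t = begin
      form β (α (fold s α k)) t     ≡⟨ α-adjoint (fold s α k) t ⟩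
      form β (fold s α k) (α t)     ≡⟨ iterate-adjoint k s (α t) ⟩
      form β s (fold (α t) α k)     ≡⟨ cong (form β s) (fold-+ t α k {1}) ⟨
      form β s (fold t α (k + 1))   ≡⟨ cong (form β s ∘ fold t α) (ℕ.+-comm k 1) ⟩
      form β s (α (fold t α k))     ∎

    -- α^(2k+1) = 1 makes γ = α^k self-adjoint for β with γ α γ = 1.
    iterate-isometry : ∀ k → (∀ s → fold s α (suc (k + k)) ≡ s) →
      ∀ s t → form β′ (fold s α k) (fold t α k) ≡ form β s t
    iterate-isometry k α-odd s t = begin
      form β′ (fold s α k) (fold t α k)        ≡⟨ α-form (fold s α k) (fold t α k) ⟨
      form β (fold s α (suc k)) (fold t α k)   ≡⟨ iterate-adjoint k (fold s α (suc k)) t ⟨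
      form β (fold (fold s α (suc k)) α k) t   ≡⟨ cong (λ u → form β u t) (fold-+ s α k) ⟨
      form β (fold s α (k + suc k)) t          ≡⟨ cong (λ m → form β (fold s α m) t) (ℕ.+-suc k k) ⟩
      form β (fold s α (suc (k + k))) t        ≡⟨ cong (λ u → form β u t) (α-odd s) ⟩
      form β s t                               ∎

  isometry : ∀ S → Simple S → (β β′ : InvariantForm S) →
    Σ (Vec₂ (dim S) → Vec₂ (dim S)) λ γ → Additive γ × Equivariant S γ ×
      (∀ s t → form β′ (γ s) (γ t) ≡ form β s t)
  isometry S S-simple β β′ =
    let (α , α-form) = form-quotient S β β′
        open FormQuotient S β β′ α α-form
        (k , α-odd) = odd-order S S-simple α α-⊕ α-· α-injective
    in (λ s → fold s α k) , iterate-⊕ α α-⊕ k , iterate-· S α α-· k , iterate-isometry k α-odd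

  -- The isotropic diagonal of two orthogonal isometric sections

  module Diagonal {C D D′ : Submodule G} (S : Rep G) (C⋖D : C ⋖ D) (C⋖D′ : C ⋖ D′)
    (D-nd : D ∩ D ^⊥ ⊑ C) (D′⊑D⊥ : D′ ⊑ D ^⊥)
    (D-iso : QuotientIso C D S) (D′-iso : QuotientIso C D′ S)
    (γ : Vec₂ (dim S) → Vec₂ (dim S)) (γ-⊕ : Additive γ) (γ-· : Equivariant S γ)
    (γ-isometry : ∀ x y x′ y′ → x ∈ D → y ∈ D → x′ ∈ D′ → y′ ∈ D′ →
       proj₁ D′-iso x′ ≡ γ (proj₁ D-iso x) → proj₁ D′-iso y′ ≡ γ (proj₁ D-iso y) → dot x′ y′ ≡ dot x y) where

    open Σ D-iso renaming (proj₁ to f ; proj₂ to f-laws)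
    open Σ D′-iso renaming (proj₁ to f′ ; proj₂ to f′-laws)

    f-⊕     = proj₁ f-laws
    f-·     = proj₁ (proj₂ f-laws)
    f-ker   = proj₂ (proj₂ (proj₂ f-laws))
    f′-⊕    = proj₁ f′-laws
    f′-·    = proj₁ (proj₂ f′-laws)
    f′-onto = proj₁ (proj₂ (proj₂ f′-laws))
    f′-ker  = proj₂ (proj₂ (proj₂ f′-laws))

    f-C : ∀ c → c ∈ C → f c ≡ 0v
    f-C c c∈C = from (f-ker c (incl C⋖D c c∈C)) c∈C

    C-graph : ∀ c c′ → c ∈ C → c′ ∈ C → f′ c′ ≡ γ (f c)
    C-graph c c′ c∈C c′∈C = begin
      f′ c′      ≡⟨ from (f′-ker c′ (incl C⋖D′ c′ c′∈C)) c′∈C ⟩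
      0v         ≡⟨ additive-0 γ γ-⊕ ⟨
      γ 0v       ≡⟨ cong γ (f-C c c∈C) ⟨
      γ (f c)    ∎

    -- The graph of `γ` pulled back to `D ⊞ D′`: `v` is the sum of its `D`-part `x` and its
    -- `D′`-part `v ⊕ x`, matched by `γ`.
    E : Submodule G
    E = record
      { space = record
        { Mem  = λ v → Σ (Vec₂ n) λ x → x ∈ D × (v ⊕ x) ∈ D′ × f′ (v ⊕ x) ≡ γ (f x)
        ; mem? = λ v → vec₂-searchable λ x → (x ∈? D) ×-dec (((v ⊕ x) ∈? D′) ×-dec (f′ (v ⊕ x) ≟ γ (f x)))
        ; ∋0   = 0v , ∋0 (space D) , subst (_∈ D′) (sym (⊕-self 0v)) (∋0 (space D′)) ,
                 C-graph 0v (0v ⊕ 0v) (∋0 (space C)) (subst (_∈ C) (sym (⊕-self 0v)) (∋0 (space C)))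
        ; ∋⊕   = λ {v} {w} (x , a , a′ , e) (y , b , b′ , e′) → let eq = ⊕-interchange v x w y in
            x ⊕ y , ∋⊕ (space D) a b , subst (_∈ D′) eq (∋⊕ (space D′) a′ b′) , (begin
              f′ ((v ⊕ w) ⊕ (x ⊕ y))       ≡⟨ cong f′ eq ⟨
              f′ ((v ⊕ x) ⊕ (w ⊕ y))       ≡⟨ f′-⊕ _ _ a′ b′ ⟩
              f′ (v ⊕ x) ⊕ f′ (w ⊕ y)      ≡⟨ cong₂ _⊕_ e e′ ⟩
              γ (f x) ⊕ γ (f y)            ≡⟨ γ-⊕ (f x) (f y) ⟨
              γ (f x ⊕ f y)                ≡⟨ cong γ (f-⊕ x y a b) ⟨
              γ (f (x ⊕ y))                ∎) }
      ; ∋· = λ {v} p g (x , a , a′ , e) →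
          x ·P p , ∋· D p g a , subst (_∈ D′) (·P-⊕ p v x) (∋· D′ p g a′) , (begin
            f′ ((v ·P p) ⊕ (x ·P p))   ≡⟨ cong f′ (·P-⊕ p v x) ⟨
            f′ ((v ⊕ x) ·P p)          ≡⟨ f′-· p g (v ⊕ x) a′ ⟩
            act S p g (f′ (v ⊕ x))     ≡⟨ cong (act S p g) e ⟩
            act S p g (γ (f x))        ≡⟨ γ-· p g (f x) ⟨
            γ (act S p g (f x))        ≡⟨ cong γ (f-· p g x a) ⟨
            γ (f (x ·P p))             ∎) }

    C⊑E : C ⊑ E
    C⊑E c c∈C = c , incl C⋖D c c∈C , incl C⋖D′ _ cc∈C , C-graph c (c ⊕ c) c∈C cc∈C
      where cc∈C = ∋⊕ (space C) c∈C c∈C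

    -- The mixed terms vanish because `D′` is orthogonal to `D`; the two remaining terms are equal
    -- by the isometry and cancel.
    E⊑E⊥ : E ⊑ E ^⊥
    E⊑E⊥ v (x , a , a′ , e) w (y , b , b′ , e′) = begin
      dot v w                                ≡⟨ cong₂ dot (⊕-cancelʳ v x) (⊕-cancelʳ w y) ⟨
      dot (x′ ⊕ x) (y′ ⊕ y)                  ≡⟨ dot-⊕ˡ x′ x (y′ ⊕ y) ⟩
      dot x′ (y′ ⊕ y) xor dot x (y′ ⊕ y)     ≡⟨ cong₂ _xor_ (dot-⊕ʳ x′ y′ y) (dot-⊕ʳ x y′ y) ⟩
      (dot x′ y′ xor dot x′ y) xor (dot x y′ xor dot x y)
        ≡⟨ cong₂ (λ i j → (dot x′ y′ xor i) xor (j xor dot x y))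
             (D′⊑D⊥ x′ a′ y b) (trans (dot-comm x y′) (D′⊑D⊥ y′ b′ x a)) ⟩
      (dot x′ y′ xor false) xor dot x y      ≡⟨ cong (_xor dot x y) (xor-identityʳ (dot x′ y′)) ⟩
      dot x′ y′ xor dot x y                  ≡⟨ cong (_xor dot x y) (γ-isometry x y x′ y′ a b a′ b′ e e′) ⟩
      dot x y xor dot x y                    ≡⟨ xor-same (dot x y) ⟩
      false                                  ∎
      where
      x′ = v ⊕ x
      y′ = w ⊕ y

    E-new : Σ (Vec₂ n) λ v → v ∈ E × ¬ v ∈ C
    E-new with new C⋖D
    ... | x , x∈D , x∉C with f′-onto (γ (f x))
    ... | x′ , x′∈D′ , e = x ⊕ x′ , (x , x∈D , subst (_∈ D′) (sym eq) x′∈D′ , trans (cong f′ eq) e) ,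
      -- If x + x′ were in `C`, then `x` would lie in `D′`, hence in `D ∩ D ^⊥`, hence in `C`.
      λ xx′∈C → x∉C (D-nd x (x∈D , D′⊑D⊥ x (∋-cancelʳ (space D′) x x′ (incl C⋖D′ _ xx′∈C) x′∈D′)))
      where
      eq : (x ⊕ x′) ⊕ x ≡ x′
      eq = trans (⊕-comm (x ⊕ x′) x) (⊕-cancelˡ x x′)

  isotropic-diagonal : ∀ {C D D′} S → C ⋖ D → C ⋖ D′ → D ⊑ C ^⊥ → D′ ⊑ C ^⊥ →
    D ∩ D ^⊥ ⊑ C → D′ ∩ D′ ^⊥ ⊑ C → D′ ⊑ D ^⊥ → Simple S → QuotientIso C D S → QuotientIso C D′ S →
    Σ (Submodule G) λ E → C ⊑ E × E ⊑ E ^⊥ × Σ (Vec₂ n) λ v → v ∈ E × ¬ v ∈ C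
  isotropic-diagonal {C} {D} {D′} S C⋖D C⋖D′ D⊑C⊥ D′⊑C⊥ D-nd D′-nd D′⊑D⊥ S-simple D-iso D′-iso =
    let (β , β-dot)                    = section-form C D S (incl C⋖D) D⊑C⊥ D-nd D-iso
        (β′ , β′-dot)                  = section-form C D′ S (incl C⋖D′) D′⊑C⊥ D′-nd D′-iso
        (γ , γ-⊕ , γ-· , γ-isometry)   = isometry S S-simple β β′
        open Diagonal S C⋖D C⋖D′ D-nd D′⊑D⊥ D-iso D′-iso γ γ-⊕ γ-·
          (λ x y x′ y′ a b a′ b′ e e′ → begin
            dot x′ y′                                            ≡⟨ β′-dot x′ y′ a′ b′ ⟨
            form β′ (proj₁ D′-iso x′) (proj₁ D′-iso y′)          ≡⟨ cong₂ (form β′) e e′ ⟩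
            form β′ (γ (proj₁ D-iso x)) (γ (proj₁ D-iso y))      ≡⟨ γ-isometry (proj₁ D-iso x) (proj₁ D-iso y) ⟩
            form β (proj₁ D-iso x) (proj₁ D-iso y)               ≡⟨ β-dot x y a b ⟩
            dot x y                                              ∎)
    in E , C⊑E , E⊑E⊥ , E-new

  -- Multiplicities

  fromBool : (W : Vec₂ n → Bool) → IsPermSubmodule G W → Submodule G
  fromBool W (W-0 , W-⊕ , W-·) = record
    { space = record { Mem = T ∘ W ; mem? = T? ∘ W ; ∋0 = W-0 ; ∋⊕ = λ {u} {v} → W-⊕ u v }
    ; ∋· = λ {v} p g → W-· p g v }

  toBool : Submodule G → Vec₂ n → Bool
  toBool U v = ⌊ v ∈? U ⌋

  toBool⇒ : ∀ U v → T (toBool U v) → v ∈ U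
  toBool⇒ U v = toWitness {a? = v ∈? U}

  toBool⇐ : ∀ U v → v ∈ U → T (toBool U v)
  toBool⇐ U v = fromWitness {a? = v ∈? U}

  toBool-isSubmodule : ∀ U → IsPermSubmodule G (toBool U)
  toBool-isSubmodule U =
    toBool⇐ U 0v (∋0 (space U)) ,
    (λ u v p q → toBool⇐ U (u ⊕ v) (∋⊕ (space U) (toBool⇒ U u p) (toBool⇒ U v q))) ,
    λ p g v a → toBool⇐ U (v ·P p) (∋· U p g (toBool⇒ U v a))

  module Series (cs : CompositionSeries G) where

    level : Fin (suc (len cs)) → Submodule G
    level i = fromBool (W cs i) (W-sub cs i)

    level-⋖ : ∀ i → level (inject₁ i) ⋖ level (suc i)
    level-⋖ i = record
      { incl = W-incl cs i
      ; new = W-prop cs i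
      ; between = λ U A⊑U U⊑B →
          case W-max cs i (toBool U) (toBool-isSubmodule U)
                 (λ v → toBool⇐ U v ∘ A⊑U v) (λ v → U⊑B v ∘ toBool⇒ U v) of λ
            { (inj₁ U⊆A) → inj₁ λ v → U⊆A v ∘ toBool⇐ U v
            ; (inj₂ B⊆U) → inj₂ λ v → toBool⇒ U v ∘ B⊆U v } }

    -- The chain that the series induces on `U` moves at `i`. Its factor there embeds in a simple
    -- module, so it is either zero or all of level (i+1) / level i.
    Jump : Fin (len cs) → Submodule G → Set
    Jump i U = Σ (Vec₂ n) λ v → v ∈ U × v ∈ level (suc i) × ¬ v ∈ level (inject₁ i)

    jump? : ∀ i U → Dec (Jump i U)
    jump? i U = vec₂-searchable λ v → (v ∈? U) ×-dec ((v ∈? level (suc i)) ×-dec ¬? (v ∈? level (inject₁ i)))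

    jump-mono : ∀ U X → U ⊑ X → ∀ i → Jump i U → Jump i X
    jump-mono U X U⊑X i (v , v∈U , r) = v , U⊑X v v∈U , r

    no-jump : ∀ i U → ¬ Jump i U → ∀ v → v ∈ U → v ∈ level (suc i) → v ∈ level (inject₁ i)
    no-jump i U ¬jump v v∈U v∈ = decidable-stable (v ∈? level (inject₁ i)) λ v∉ → ¬jump (v , v∈U , v∈ , v∉)

    escape : ∀ A B j → ¬ (B ∩ level j ⊑ A) → Σ (Vec₂ n) λ v → v ∈ B ∩ level j × ¬ v ∈ A
    escape A B j ⋢A with ⊑-or-witness (B ∩ level j) A
    ... | inj₁ ⊑A = contradiction ⊑A ⋢A
    ... | inj₂ w  = w

    -- `B ∩ Wt` has nonzero image in both simple quotients `B/A` and `Wt/Wb`, so it maps onto both,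
    -- and `butterfly` applies once the kernels are seen to agree.
    module NewJump {A B : Submodule G} (A⋖B : A ⋖ B) (i : Fin (len cs))
                   (below : B ∩ level (inject₁ i) ⊑ A)
                   (x : Vec₂ n) (x∈B : x ∈ B) (x∈Wt : x ∈ level (suc i)) (x∉A : ¬ x ∈ A) where
      Wb = level (inject₁ i)
      Wt = level (suc i)

      x∉Wb : ¬ x ∈ Wb
      x∉Wb x∈Wb = x∉A (below x (x∈B , x∈Wb))

      jump-B : Jump i B
      jump-B = x , x∈B , x∈Wt , x∉Wb

      B-split : ∀ y → y ∈ B → Σ (Vec₂ n) λ z → z ∈ B ∩ Wt × (y ⊕ z) ∈ A
      B-split y y∈B with ⋖-sum A⋖B (B ∩ Wt) (λ _ → proj₁) x (x∈B , x∈Wt) x∉A y y∈B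
      ... | a , a∈A , ya∈ = y ⊕ a , ya∈ , subst (_∈ A) (sym (⊕-cancelˡ y a)) a∈A

      Wt-split : ∀ w → w ∈ Wt → Σ (Vec₂ n) λ z → z ∈ B ∩ Wt × (w ⊕ z) ∈ Wb
      Wt-split w w∈Wt with ⋖-sum (level-⋖ i) (B ∩ Wt) (λ _ → proj₂) x (x∈B , x∈Wt) x∉Wb w w∈Wt
      ... | a , a∈Wb , wa∈ = w ⊕ a , wa∈ , subst (_∈ Wb) (sym (⊕-cancelˡ w a)) a∈Wb

      Wb⇒A : ∀ z → z ∈ B ∩ Wt → z ∈ Wb → z ∈ A
      Wb⇒A z (z∈B , _) z∈Wb = below z (z∈B , z∈Wb)

      -- A jump of `A` would give `Wt` = `Wb` + (`A ∩ Wt`). Then `x` differs from an element of `A`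
      -- by an element of `B ∩ Wb`, which is in `A` by `below`, and so `x` would be in `A`.
      ¬jump-A : ¬ Jump i A
      ¬jump-A (y , y∈A , y∈Wt , y∉Wb)
        with ⋖-sum (level-⋖ i) (A ∩ Wt) (λ _ → proj₂) y (y∈A , y∈Wt) y∉Wb x x∈Wt
      ... | w , w∈Wb , (xw∈A , _) = x∉A (∋-cancelʳ (space A) x w xw∈A
              (below w (∋-cancelˡ (space B) x w (incl A⋖B _ xw∈A) x∈B , w∈Wb)))

      A⇒Wb : ∀ z → z ∈ B ∩ Wt → z ∈ A → z ∈ Wb
      A⇒Wb z (_ , z∈Wt) z∈A = no-jump i A ¬jump-A z z∈A z∈Wt

      iso⇒ : ∀ S → QuotientIso A B S → QuotientIso Wb Wt S
      iso⇒ S = butterfly A B Wb Wt S B-split Wt-split A⇒Wb Wb⇒A (incl A⋖B)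

      iso⇐ : ∀ S → QuotientIso Wb Wt S → QuotientIso A B S
      iso⇐ S = butterfly Wb Wt A B S
        (λ w w∈ → map₂ (λ ((p , q) , r) → (q , p) , r) (Wt-split w w∈))
        (λ y y∈ → map₂ (λ ((p , q) , r) → (q , p) , r) (B-split y y∈))
        (λ z (p , q) → Wb⇒A z (q , p)) (λ z (p , q) → A⇒Wb z (q , p)) (incl (level-⋖ i))

    -- Below the threshold `B ∩ level (suc j)` is inside `A` already. Above it `B` = `A` +
    -- (`B ∩ level j`), so the jumping vector may be corrected into `A` without changing its class
    -- modulo level j.
    old-jump : ∀ {A B} → A ⋖ B → ∀ j → (B ∩ level (suc j) ⊑ A) ⊎ ¬ (B ∩ level (inject₁ j) ⊑ A) → Jump j B → Jump j A
    old-jump {A} {B} A⋖B j (inj₁ ⊑A) (y , y∈B , y∈ , y∉) = y , ⊑A y (y∈B , y∈) , y∈ , y∉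
    old-jump {A} {B} A⋖B j (inj₂ ⋢A) (y , y∈B , y∈ , y∉) =
      let (z , z∈ , z∉A)          = escape A B (inject₁ j) ⋢A
          (a , a∈A , (_ , ya∈W)) = ⋖-sum A⋖B (B ∩ level (inject₁ j)) (λ _ → proj₁) z z∈ z∉A y y∈B
      in a , a∈A , ∋-cancelˡ (space (level (suc j))) y a (W-incl cs j _ ya∈W) y∈ ,
         λ a∈W → y∉ (∋-cancelʳ (space (level (inject₁ j))) y a ya∈W a∈W)

    -- The new jump is at the index where B ∩ level i stops being contained in A.
    ⋖-jump : ∀ {A B} → A ⋖ B → Σ (Fin (len cs)) λ k →
      Jump k B × ¬ Jump k A × (∀ j → j ≢ k → Jump j B → Jump j A) ×
      (∀ S → QuotientIso A B S → QuotientIso (level (inject₁ k)) (level (suc k)) S) ×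
      (∀ S → QuotientIso (level (inject₁ k)) (level (suc k)) S → QuotientIso A B S)
    ⋖-jump {A} {B} A⋖B =
      let (i , below , above , others) = crossing
            (λ i → all? vec₂-searchable λ v → (v ∈? (B ∩ level i)) →-dec (v ∈? A))
            (λ i p v (v∈B , v∈W) → p v (v∈B , W-incl cs i v v∈W))
            (λ v (_ , v∈W₀) → subst (_∈ A) (sym (W-zero cs v v∈W₀)) (∋0 (space A)))
            (λ p → let (v , v∈B , v∉A) = new A⋖B in v∉A (p v (v∈B , W-top cs v)))
          (x , (x∈B , x∈Wt) , x∉A) = escape A B (suc i) above
          open NewJump A⋖B i below x x∈B x∈Wt x∉A
      in i , jump-B , ¬jump-A , (λ j j≢i → old-jump A⋖B j (others j j≢i)) , iso⇒ , iso⇐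

    module Multiplicity (S : Rep G) (marks : Fin (len cs) → Bool)
                        (marks-iso : ∀ i → T (marks i) ⇔ FactorIso cs i S) where

      -- By mult-⋖ this is the multiplicity of S in U itself, so it does not depend on cs.
      mult : Submodule G → ℕ
      mult U = countTrue λ i → marks i ∧ ⌊ jump? i U ⌋

      mult-cong : ∀ U X → U ⊑ X → X ⊑ U → mult U ≡ mult X
      mult-cong U X U⊑X X⊑U = countTrue-cong _ _ λ i →
        cong (marks i ∧_) (⌊⌋-cong (jump? i U) (jump? i X) (jump-mono U X U⊑X i) (jump-mono X U X⊑U i))

      mult-0 : ∀ U → U ⊑ 0ₛ → mult U ≡ 0
      mult-0 U U⊑0 = countTrue-false _ λ i → trans (cong (marks i ∧_) (⌊⌋-false (jump? i U)
        λ (v , v∈U , _ , v∉) → v∉ (subst (_∈ level (inject₁ i)) (sym (U⊑0 v v∈U)) (∋0 (space (level (inject₁ i)))))))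
        (∧-zeroʳ (marks i))

      mult-jump : ∀ {A B} → A ⋖ B → ∀ k → Jump k B → ¬ Jump k A → (∀ j → j ≢ k → Jump j B → Jump j A) →
                  mult B ≡ bool→ℕ (marks k) + mult A
      mult-jump {A} {B} A⋖B k jump-B ¬jump-A others = begin
        mult B                                     ≡⟨ countTrue-single _ _ k agree not-A ⟩
        bool→ℕ (marks k ∧ ⌊ jump? k B ⌋) + mult A
          ≡⟨ cong (λ b → bool→ℕ (marks k ∧ b) + mult A) (⌊⌋-true (jump? k B) jump-B) ⟩
        bool→ℕ (marks k ∧ true) + mult A           ≡⟨ cong (λ b → bool→ℕ b + mult A) (Bool.∧-identityʳ (marks k)) ⟩
        bool→ℕ (marks k) + mult A                  ∎
        where
        agree : ∀ j → j ≢ k → (marks j ∧ ⌊ jump? j B ⌋) ≡ (marks j ∧ ⌊ jump? j A ⌋)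
        agree j j≢k = cong (marks j ∧_)
          (⌊⌋-cong (jump? j B) (jump? j A) (others j j≢k) (jump-mono A B (incl A⋖B) j))
        not-A : (marks k ∧ ⌊ jump? k A ⌋) ≡ false
        not-A = trans (cong (marks k ∧_) (⌊⌋-false (jump? k A) ¬jump-A)) (∧-zeroʳ (marks k))

      -- The substitute for Jordan-Hölder: the mark at the single new jump tells whether `B/A` is
      -- isomorphic to `S`.
      mult-⋖ : ∀ {A B} → A ⋖ B → Σ Bool λ b → mult B ≡ bool→ℕ b + mult A × (T b ⇔ QuotientIso A B S)
      mult-⋖ {A} {B} A⋖B =
        let (k , jump-B , ¬jump-A , others , iso⇒ , iso⇐) = ⋖-jump A⋖B in
        marks k , mult-jump A⋖B k jump-B ¬jump-A others ,
        mk⇔ (λ t → iso⇐ S (to (marks-iso k) t)) (λ iso → from (marks-iso k) (iso⇒ S iso))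

      -- Descend the chain (level i + U)^⊥ from U^⊥ to 0: the step at i is trivial if U jumps at i, and
      -- otherwise its factor is dual to level (i+1) / level i.
      mult-⊥ : Simple S → SelfDualModule S → ∀ U → countTrue marks ≡ mult U + mult (U ^⊥)
      mult-⊥ S-simple S-dual U = begin
        countTrue marks
          ≡⟨ countTrue-split marks (λ i → ⌊ jump? i U ⌋) ⟩
        mult U + countTrue (λ i → marks i ∧ not ⌊ jump? i U ⌋)
          ≡⟨ cong (mult U +_) (ℕ.+-identityʳ (countTrue (λ i → marks i ∧ not ⌊ jump? i U ⌋))) ⟨
        mult U + (countTrue (λ i → marks i ∧ not ⌊ jump? i U ⌋) + 0)
          ≡⟨ cong (λ m → mult U + (countTrue (λ i → marks i ∧ not ⌊ jump? i U ⌋) + m)) (mult-0 (X (fromℕ (len cs))) X-top) ⟨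
        mult U + (countTrue (λ i → marks i ∧ not ⌊ jump? i U ⌋) + mult (X (fromℕ (len cs))))
          ≡⟨ cong (mult U +_) (telescope (mult ∘ X) (λ i → marks i ∧ not ⌊ jump? i U ⌋) λ i → step i (jump? i U)) ⟨
        mult U + mult (X zero)
          ≡⟨ cong (mult U +_) (mult-cong (X zero) (U ^⊥) (λ _ → proj₂) X-bottom) ⟩
        mult U + mult (U ^⊥) ∎
        where
        X : Fin (suc (len cs)) → Submodule G
        X i = level i ^⊥ ∩ U ^⊥

        X-bottom : U ^⊥ ⊑ X zero
        X-bottom v v⊥ = (λ u u∈W₀ → trans (cong (dot v) (W-zero cs u u∈W₀)) (dot-0ʳ v)) , v⊥

        X-top : X (fromℕ (len cs)) ⊑ 0ₛ
        X-top v (v⊥ , _) = ⊥⊥⇒∈ 0ₛ v λ u _ → v⊥ u (W-top cs u)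

        X-antitone : ∀ i → X (suc i) ⊑ X (inject₁ i)
        X-antitone i v (v⊥W , v⊥U) = (λ u u∈W → v⊥W u (W-incl cs i u u∈W)) , v⊥U

        step : ∀ i (j? : Dec (Jump i U)) → mult (X (inject₁ i)) ≡ bool→ℕ (marks i ∧ not ⌊ j? ⌋) + mult (X (suc i))
        step i (yes (x , x∈U , x∈Wt , x∉Wb)) = begin
          mult (X (inject₁ i))                                ≡⟨ mult-cong (X (inject₁ i)) (X (suc i)) stationary (X-antitone i) ⟩
          mult (X (suc i))                                    ≡⟨ cong (λ b → bool→ℕ b + mult (X (suc i))) (∧-zeroʳ (marks i)) ⟨
          bool→ℕ (marks i ∧ false) + mult (X (suc i))         ∎
          where
          -- A jump of `U` at `i` puts level (i+1) inside level i + `U`, so both levels have the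
          -- same sum with `U`, hence the same orthogonal.
          stationary : X (inject₁ i) ⊑ X (suc i)
          stationary v (v⊥W , v⊥U) = (λ w w∈Wt →
            let (a , a∈Wb , (wa∈U , _)) = ⋖-sum (level-⋖ i) (U ∩ level (suc i)) (λ _ → proj₂) x (x∈U , x∈Wt) x∉Wb w w∈Wt
            in ⊥-sum (level (inject₁ i)) U v (v⊥W , v⊥U) w (a , a∈Wb , wa∈U)) , v⊥U
        step i (no ¬jump) = let (b , eq , b-iso) = mult-⋖ X-⋖ in
          trans eq (cong (λ b → bool→ℕ b + mult (X (suc i))) (trans (same-mark b b-iso) (sym (Bool.∧-identityʳ (marks i)))))
          where
          Wb = level (inject₁ i)
          Wt = level (suc i)

          -- The modular law: `Wt ∩ (Wb ⊞ U)` = `Wb` + (`Wt ∩ U`), and without a jump `Wt ∩ U` lies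
          -- in `Wb`.
          Wb⊞U∩Wt : ∀ w → w ∈ Wt → w ∈ Wb ⊞ U → w ∈ Wb
          Wb⊞U∩Wt w w∈Wt (a , a∈Wb , wa∈U) = ∋-cancelʳ (space Wb) w a
            (no-jump i U ¬jump _ wa∈U (∋⊕ (space Wt) w∈Wt (W-incl cs i a a∈Wb))) a∈Wb

          X-new : Σ (Vec₂ n) λ y → y ∈ X (inject₁ i) × ¬ y ∈ X (suc i)
          X-new with W-prop cs i
          ... | w , w∈Wt , w∉Wb with separation (space (Wb ⊞ U)) w (w∉Wb ∘ Wb⊞U∩Wt w w∈Wt)
          ... | y , y⊥ , yw = y , ((λ u → y⊥ u ∘ ⊞-left Wb U u) , (λ u → y⊥ u ∘ ⊞-right Wb U u)) ,
                λ (y⊥Wt , _) → true≢false yw (y⊥Wt w w∈Wt)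

          X-⋖ : X (suc i) ⋖ X (inject₁ i)
          X-⋖ = record { incl = X-antitone i ; new = X-new ; between = between-X }
            where
            -- Orthogonality carries `Y` to `Wt ∩ Y ^⊥`, which lies between `Wb` and `Wt`. If it is
            -- `Wt`, then `Y` is orthogonal to `Wt`. If it is `Wb`, then `Y ^⊥`, being contained in
            -- `Wt ⊞ U` and containing `U`, is contained in `Wb ⊞ U`; taking orthogonals again gives
            -- the inclusion.
            between-X : ∀ Y → X (suc i) ⊑ Y → Y ⊑ X (inject₁ i) → Y ⊑ X (suc i) ⊎ X (inject₁ i) ⊑ Y
            between-X Y Xt⊑Y Y⊑Xb with between (level-⋖ i) (Wt ∩ Y ^⊥)
                (λ w w∈Wb → W-incl cs i w w∈Wb , λ y y∈Y → trans (dot-comm w y) (proj₁ (Y⊑Xb y y∈Y) w w∈Wb)) (λ _ → proj₁)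
            ... | inj₂ Wt⊑ = inj₁ λ y y∈Y →
                  (λ w w∈Wt → trans (dot-comm y w) (proj₂ (Wt⊑ w w∈Wt) y y∈Y)) , proj₂ (Y⊑Xb y y∈Y)
            ... | inj₁ ⊑Wb = inj₂ λ x (x⊥Wb , x⊥U) → ⊥⊥⇒∈ Y x λ y y⊥Y →
                  let (w , w∈Wt , yw∈U) = ⊥⊥⇒∈ (Wt ⊞ U) y λ v v⊥ → y⊥Y v
                        (Xt⊑Y v ((λ u → v⊥ u ∘ ⊞-left Wt U u) , (λ u → v⊥ u ∘ ⊞-right Wt U u)))
                      yw⊥Y = λ v v∈Y → trans (dot-comm (y ⊕ w) v) (proj₂ (Y⊑Xb v v∈Y) _ yw∈U)
                      w⊥Y = ∋-cancelˡ (space (Y ^⊥)) y w yw⊥Y y⊥Y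
                  in ⊥-sum Wb U x (x⊥Wb , x⊥U) y (w , ⊑Wb w (w∈Wt , w⊥Y) , yw∈U)

          dualize : QuotientIso Wb Wt S → QuotientIso (X (suc i)) (X (inject₁ i)) S
          dualize = dual-iso Wb Wt (X (suc i)) (X (inject₁ i)) S S-simple S-dual
            (λ y → proj₁) (λ y (_ , y⊥U) y⊥Wt → y⊥Wt , y⊥U) (λ y → proj₁) X-new

          undualize : QuotientIso (X (suc i)) (X (inject₁ i)) S → QuotientIso Wb Wt S
          undualize = dual-iso (X (suc i)) (X (inject₁ i)) Wb Wt S S-simple S-dual
            (λ w w∈Wt x (x⊥Wt , _) → trans (dot-comm w x) (x⊥Wt w w∈Wt))
            (λ w w∈Wt w⊥X → Wb⊞U∩Wt w w∈Wt (⊥⊥⇒∈ (Wb ⊞ U) w λ v v⊥ → w⊥X v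
              ((λ u → v⊥ u ∘ ⊞-left Wb U u) , (λ u → v⊥ u ∘ ⊞-right Wb U u))))
            (λ w w∈Wb x (x⊥Wb , _) → trans (dot-comm w x) (x⊥Wb w w∈Wb))
            (W-prop cs i)

          same-mark : ∀ b → (T b ⇔ QuotientIso (X (suc i)) (X (inject₁ i)) S) → b ≡ marks i
          same-mark b b-iso = T-ext (λ t → from (marks-iso i) (undualize (to b-iso t)))
                                    (λ t → from b-iso (dualize (to (marks-iso i) t)))

  -- Existence of composition series

  record Chain (A : Submodule G) : Set₁ where
    field
      length : ℕ
      term   : Fin (suc length) → Submodule G
      start  : term zero ≡ A
      cover  : ∀ i → term (inject₁ i) ⋖ term (suc i)
      end    : ⊤ₛ ⊑ term (fromℕ length)

  cons : ∀ {A B} → A ⋖ B → Chain B → Chain A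
  cons {A} A⋖B c = record
    { length = suc length
    ; term   = λ { zero → A ; (suc i) → term i }
    ; start  = refl
    ; cover  = λ { zero → subst (A ⋖_) (sym start) A⋖B ; (suc i) → cover i }
    ; end    = end }
    where open Chain c

  -- Covers are stacked from `A` upwards; the complement shrinks with each one.
  chain-exists : ∀ A → ¬ ¬ Chain A
  chain-exists A = ascend A (<-wellFounded _)
    where
    ascend : ∀ A → Acc _<_ (card (¬? ∘ mem? (space A))) → ¬ ¬ Chain A
    ascend A (acc rs) κ with ⊑-or-witness ⊤ₛ A
    ... | inj₁ ⊤⊑A = κ (record { length = 0 ; term = λ _ → A ; start = refl ; cover = λ () ; end = ⊤⊑A })
    ... | inj₂ (v , _ , v∉A) = ⋖-exists A ⊤ₛ (λ _ _ → tt) v tt v∉A λ (B , A⋖B , _) →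
      let (w , w∈B , w∉A) = new A⋖B in
      ascend B (rs (cocard-⊏ A B (incl A⋖B) w w∈B w∉A)) (κ ∘ cons A⋖B)

  compositionSeries : Chain 0ₛ → CompositionSeries G
  compositionSeries c = record
    { len    = length
    ; W      = toBool ∘ term
    ; W-sub  = toBool-isSubmodule ∘ term
    ; W-zero = λ v t → subst (v ∈_) start (toBool⇒ (term zero) v t)
    ; W-top  = λ v → toBool⇐ (term (fromℕ length)) v (end v tt)
    ; W-incl = λ i v t → toBool⇐ (term (suc i)) v (incl (cover i) v (toBool⇒ (term (inject₁ i)) v t))
    ; W-prop = λ i → let (v , v∈ , v∉) = new (cover i) in
        v , toBool⇐ (term (suc i)) v v∈ , v∉ ∘ toBool⇒ (term (inject₁ i)) v
    ; W-max  = λ i U U-sub ⊆U U⊆ →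
        case between (cover i) (fromBool U U-sub) (λ v → ⊆U v ∘ toBool⇐ (term (inject₁ i)) v)
                     (λ v → toBool⇒ (term (suc i)) v ∘ U⊆ v) of λ
          { (inj₁ U⊑) → inj₁ λ v → toBool⇐ (term (inject₁ i)) v ∘ U⊑ v
          ; (inj₂ ⊑U) → inj₂ λ v → ⊑U v ∘ toBool⇒ (term (suc i)) v } }
    where open Chain c

  -- Nondegenerate pieces over a maximal self-orthogonal submodule

  peel : ∀ {C D Q} → C ⋖ D → D ∩ D ^⊥ ⊑ C → C ⊑ Q → D ⊑ Q → Q ⊑ C ^⊥ →
    (Q ∩ D ^⊥ ⋖ Q) × (∀ S → QuotientIso (Q ∩ D ^⊥) Q S → QuotientIso C D S)
  peel {C} {D} {Q} C⋖D D-nd C⊑Q D⊑Q Q⊑C⊥ =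
    record { incl = λ _ → proj₁ ; new = Q-new ; between = between-Q } ,
    -- The second isomorphism theorem: `Q` = `D` + `Q′` and `D ∩ Q′` = `C`.
    λ S → butterfly Q′ Q C D S
      (λ q q∈Q → let (d , d∈D , qd∈Q′) = split q q∈Q in d , (D⊑Q d d∈D , d∈D) , qd∈Q′)
      (λ d d∈D → d , (D⊑Q d d∈D , d∈D) , subst (_∈ C) (sym (⊕-self d)) (∋0 (space C)))
      (λ z (_ , z∈D) (_ , z⊥D) → D-nd z (z∈D , z⊥D))
      (λ z _ → C⊑Q′ z)
      (λ _ → proj₁)
    where
    Q′ = Q ∩ D ^⊥

    C⊑Q′ : C ⊑ Q′
    C⊑Q′ c c∈C = C⊑Q c c∈C , λ d d∈D → trans (dot-comm c d) (Q⊑C⊥ d (D⊑Q d d∈D) c c∈C)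

    -- Whatever is orthogonal to `D ⊞ D ^⊥` lies in `D ∩ D ^⊥`, hence in `C`, hence is orthogonal to
    -- `q`; so `q` belongs to `D ⊞ D ^⊥`.
    split : ∀ q → q ∈ Q → Σ (Vec₂ n) λ d → d ∈ D × (q ⊕ d) ∈ Q′
    split q q∈Q = let (d , d∈D , qd⊥D) = ⊥⊥⇒∈ (D ⊞ D ^⊥) q λ y y⊥ → Q⊑C⊥ q q∈Q y
                        (D-nd y (⊥⊥⇒∈ D y (λ u → y⊥ u ∘ ⊞-right D (D ^⊥) u) , λ u → y⊥ u ∘ ⊞-left D (D ^⊥) u))
                  in d , d∈D , ∋⊕ (space Q) q∈Q (D⊑Q d d∈D) , qd⊥D

    Q-new : Σ (Vec₂ n) λ v → v ∈ Q × ¬ v ∈ Q′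
    Q-new = let (v , v∈D , v∉C) = new C⋖D in v , D⊑Q v v∈D , λ (_ , v⊥D) → v∉C (D-nd v (v∈D , v⊥D))

    between-Q : ∀ U → Q′ ⊑ U → U ⊑ Q → U ⊑ Q′ ⊎ Q ⊑ U
    between-Q U Q′⊑U U⊑Q
      with between C⋖D (U ∩ D) (λ c c∈C → Q′⊑U c (C⊑Q′ c c∈C) , incl C⋖D c c∈C) (λ _ → proj₂)
    ... | inj₁ ⊑C = inj₁ λ u u∈U → let (d , d∈D , ud∈Q′) = split u (U⊑Q u u∈U) in
          ∋-cancelʳ (space Q′) u d ud∈Q′ (C⊑Q′ d (⊑C d (∋-cancelˡ (space U) u d (Q′⊑U _ ud∈Q′) u∈U , d∈D)))
    ... | inj₂ D⊑ = inj₂ λ q q∈Q → let (d , d∈D , qd∈Q′) = split q q∈Q in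
          ∋-cancelʳ (space U) q d (Q′⊑U _ qd∈Q′) (proj₁ (D⊑ d d∈D))

  module Obstruction
    (even : ∀ S → Simple S → SelfDualModule S → EvenMultiplicity G S)
    (C : Submodule G) (C⊑C⊥ : C ⊑ C ^⊥)
    (C-maximal : ∀ E → C ⊑ E → E ⊑ E ^⊥ → E ⊑ C) where

    -- The radical `D ∩ D ^⊥` contains `C`, so it is `C` or `D`; in the second case `D` would be
    -- self-orthogonal and larger than `C`.
    anisotropic : ∀ {D} → C ⋖ D → D ⊑ C ^⊥ → D ∩ D ^⊥ ⊑ C
    anisotropic {D} C⋖D D⊑C⊥
      with between C⋖D (D ∩ D ^⊥)
             (λ c c∈C → incl C⋖D c c∈C , λ d d∈D → trans (dot-comm c d) (D⊑C⊥ d d∈D c c∈C)) (λ _ → proj₁)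
    ... | inj₁ ⊑C = ⊑C
    ... | inj₂ D⊑ = let (v , v∈D , v∉C) = new C⋖D in
      contradiction (C-maximal D (incl C⋖D) (λ d → proj₂ ∘ D⊑ d) v v∈D) v∉C

    module _ {D : Submodule G} (C⋖D : C ⋖ D) (D⊑C⊥ : D ⊑ C ^⊥) where
      open QuotientModule C⋖D renaming (rep to S)

      S-dual : SelfDualModule S
      S-dual = selfDual (proj₁ (section-form C D S (incl C⋖D) D⊑C⊥ (anisotropic C⋖D D⊑C⊥) iso))

      unique-constituent : ∀ {D′} → C ⋖ D′ → D′ ⊑ D ^⊥ → ¬ QuotientIso C D′ S
      unique-constituent {D′} C⋖D′ D′⊑D⊥ iso′ =
        let (E , C⊑E , E⊑E⊥ , v , v∈E , v∉C) =
              isotropic-diagonal S C⋖D C⋖D′ D⊑C⊥ D′⊑C⊥ (anisotropic C⋖D D⊑C⊥) (anisotropic C⋖D′ D′⊑C⊥)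
                D′⊑D⊥ simple iso iso′
        in v∉C (C-maximal E C⊑E E⊑E⊥ v v∈E)
        where
        D′⊑C⊥ : D′ ⊑ C ^⊥
        D′⊑C⊥ d d∈D′ c c∈C = D′⊑D⊥ d d∈D′ c (incl C⋖D c c∈C)

      module _ (cs : CompositionSeries G) (marks : Fin (len cs) → Bool)
               (marks-iso : ∀ i → T (marks i) ⇔ FactorIso cs i S) where
        open Series cs
        open Multiplicity S marks marks-iso

        C⊑D⊥ : C ⊑ D ^⊥
        C⊑D⊥ c c∈C d d∈D = trans (dot-comm c d) (D⊑C⊥ d d∈D c c∈C)

        -- Adding 1 for `D/C` gives the even number mult V. The sum has the parity of the difference
        -- mult D^⊥ - mult C and needs no subtraction.
        D⊥-odd : ¬ 2 ∣ mult (D ^⊥) + mult C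
        D⊥-odd 2∣ = case ∣1⇒≡1 (∣m+n∣m⇒∣n (subst (2 ∣_) total (even S simple S-dual cs marks marks-iso)) 2∣) of λ ()
          where
          mult-D : mult D ≡ 1 + mult C
          mult-D = let (b , eq , b-iso) = mult-⋖ C⋖D in
            trans eq (cong (λ b → bool→ℕ b + mult C) (T-ext (λ _ → tt) (λ _ → from b-iso iso)))

          total : countTrue marks ≡ (mult (D ^⊥) + mult C) + 1
          total = begin
            countTrue marks                   ≡⟨ mult-⊥ simple S-dual D ⟩
            mult D + mult (D ^⊥)              ≡⟨ cong (_+ mult (D ^⊥)) mult-D ⟩
            1 + mult C + mult (D ^⊥)          ≡⟨ ℕ.+-comm 1 (mult C + mult (D ^⊥)) ⟩
            mult C + mult (D ^⊥) + 1          ≡⟨ cong (_+ 1) (ℕ.+-comm (mult C) (mult (D ^⊥))) ⟩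
            mult (D ^⊥) + mult C + 1          ∎

        -- Splitting off a simple piece orthogonal to D cannot remove a copy of S, so the odd
        -- multiplicity persists down to C.
        no-odd-complement : ∀ Q → Acc _<_ (card (mem? (space Q))) → C ⊑ Q → Q ⊑ D ^⊥ → ¬ ¬ 2 ∣ mult Q + mult C
        no-odd-complement Q (acc rs) C⊑Q Q⊑D⊥ odd with ⊑-or-witness Q C
        ... | inj₁ Q⊑C = odd (divides (mult C) (begin
                mult Q + mult C          ≡⟨ cong (_+ mult C) (mult-cong Q C Q⊑C C⊑Q) ⟩
                mult C + mult C          ≡⟨ cong (mult C +_) (ℕ.+-identityʳ (mult C)) ⟨
                2 ℕ.* mult C             ≡⟨ ℕ.*-comm 2 (mult C) ⟩
                mult C ℕ.* 2             ∎))
        ... | inj₂ (v , v∈Q , v∉C) = ⋖-exists C Q C⊑Q v v∈Q v∉C λ (D′ , C⋖D′ , D′⊑Q) →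
          let D′⊑D⊥          = λ x → Q⊑D⊥ x ∘ D′⊑Q x
              Q⊑C⊥           = λ q q∈Q c c∈C → Q⊑D⊥ q q∈Q c (incl C⋖D c c∈C)
              (Q′⋖Q , iso⇒)  = peel {Q = Q} C⋖D′ (anisotropic C⋖D′ (λ x → Q⊑C⊥ x ∘ D′⊑Q x)) C⊑Q D′⊑Q Q⊑C⊥
              (w , w∈Q , w∉Q′) = new Q′⋖Q
              (b , eq , b-iso) = mult-⋖ Q′⋖Q
              -- `Q/Q′` is isomorphic to `D′/C`, which cannot be `S`; so `mult` does not change from
              -- `Q` to `Q′`.
              b≡false = T-ext (unique-constituent C⋖D′ D′⊑D⊥ ∘ iso⇒ S ∘ to b-iso) ⊥-elim
          in no-odd-complement (Q ∩ D′ ^⊥) (rs (card-⊏ (Q ∩ D′ ^⊥) Q (incl Q′⋖Q) w w∈Q w∉Q′))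
               (λ c c∈C → C⊑Q c c∈C , λ d d∈D′ → trans (dot-comm c d) (Q⊑C⊥ d (D′⊑Q d d∈D′) c c∈C))
               (λ x (x∈Q , _) → Q⊑D⊥ x x∈Q)
               (odd ∘ subst (λ m → 2 ∣ m + mult C) (sym (trans eq (cong (λ b → bool→ℕ b + mult (Q ∩ D′ ^⊥)) b≡false))))

      obstruction : ⊥
      obstruction = chain-exists 0ₛ λ c → let cs = compositionSeries c in
        ¬¬-finite-choice {P = λ i → Dec (FactorIso cs i S)} (λ i → ¬¬-excluded-middle) λ iso? →
          let marks-iso = λ i → mk⇔ (toWitness {a? = iso? i}) (fromWitness {a? = iso? i}) in
          no-odd-complement cs (λ i → ⌊ iso? i ⌋) marks-iso (D ^⊥) (<-wellFounded _)
            (C⊑D⊥ cs (λ i → ⌊ iso? i ⌋) marks-iso) (λ _ → id) (D⊥-odd cs (λ i → ⌊ iso? i ⌋) marks-iso)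

  -- The two implications

  InvariantSelfDualCode : Set
  InvariantSelfDualCode = Σ (Code n) λ C → SelfDualCode C × (G ≤Aut C)

  code : ∀ C → C ⊑ C ^⊥ → C ^⊥ ⊑ C → InvariantSelfDualCode
  code C C⊑C⊥ C⊥⊑C = toBool C ,
    (λ v → mk⇔ (λ v∈C c c∈C → C⊑C⊥ v (toBool⇒ C v v∈C) c (toBool⇒ C c c∈C))
               (λ v⊥ → toBool⇐ C v (C⊥⊑C v λ c → v⊥ c ∘ toBool⇐ C c))) ,
    λ p g v → let (q , gq , pq) = inv∈ p g
                  undo : (v ·P p) ·P q ≡ v
                  undo = trans (sym (·P-∘P v p q)) (trans (cong (v ·P_) pq) (·P-identity v))
      in ⌊⌋-cong ((v ·P p) ∈? C) (v ∈? C) (λ vp∈C → subst (_∈ C) undo (∋· C q gq vp∈C)) (∋· C p g)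

  -- Codes can be searched exhaustively, so the existence of one may be proved by contradiction; the
  -- extremal submodules, the composition series and the marks are then only needed up to ¬¬.
  evenMultiplicity⇒code : (∀ S → Simple S → SelfDualModule S → EvenMultiplicity G S) → InvariantSelfDualCode
  evenMultiplicity⇒code even = decidable-stable (selfDualCode? G) λ ¬code →
    -- The size is that of the complement, so a minimum is a submodule maximal among the
    -- self-orthogonal ones; the zero submodule starts the descent.
    ¬¬-minimal {P = λ U → Level.Lift _ (U ⊑ U ^⊥)} (λ U → card (¬? ∘ mem? (space U))) 0ₛ
      (Level.lift λ { v refl u _ → dot-0ˡ u })
      λ { (C , Level.lift C⊑C⊥ , minimal) →
        let maximal : ∀ E → C ⊑ E → E ⊑ E ^⊥ → E ⊑ C
            maximal E C⊑E E⊑E⊥ = case ⊑-or-witness E C of λ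
              { (inj₁ E⊑C) → E⊑C
              ; (inj₂ (v , v∈E , v∉C)) → contradiction (cocard-⊏ C E C⊑E v v∈E v∉C) (minimal E (Level.lift E⊑E⊥)) }
        in case ⊑-or-witness (C ^⊥) C of λ
          { (inj₁ C⊥⊑C) → ¬code (code C C⊑C⊥ C⊥⊑C)
          ; (inj₂ (v , v∈C⊥ , v∉C)) → ⋖-exists C (C ^⊥) C⊑C⊥ v v∈C⊥ v∉C λ (D , C⋖D , D⊑C⊥) →
              Obstruction.obstruction even C C⊑C⊥ maximal C⋖D D⊑C⊥ } }

  code⇒evenMultiplicity : InvariantSelfDualCode → ∀ S → Simple S → SelfDualModule S → EvenMultiplicity G S
  code⇒evenMultiplicity (C , C-dual , C-aut) S S-simple S-dual cs marks marks-iso =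
    divides (mult U) (begin
      countTrue marks         ≡⟨ mult-⊥ S-simple S-dual U ⟩
      mult U + mult (U ^⊥)    ≡⟨ cong (mult U +_) (mult-cong (U ^⊥) U (λ v → from (C-dual v)) (λ v → to (C-dual v))) ⟩
      mult U + mult U         ≡⟨ cong (mult U +_) (ℕ.+-identityʳ (mult U)) ⟨
      2 ℕ.* mult U            ≡⟨ ℕ.*-comm 2 (mult U) ⟩
      mult U ℕ.* 2            ∎)
    where
    U : Submodule G
    U = fromBool C
      ( from (C-dual 0v) (λ c _ → dot-0ˡ c)
      , (λ u v u∈C v∈C → from (C-dual (u ⊕ v)) λ c c∈C →
           trans (dot-⊕ˡ u v c) (cong₂ _xor_ (to (C-dual u) u∈C c c∈C) (to (C-dual v) v∈C c c∈C)))
      , λ p g v → subst T (sym (C-aut p g v)) )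
    open Series cs
    open Multiplicity S marks marks-iso

theorem2p3 : (n : ℕ) (G : Perm n → Bool) → IsSubgroup G →
    (Σ (Code n) (λ C → SelfDualCode C × (G ≤Aut C)))
    ⇔ ((S : Rep G) → Simple S → SelfDualModule S → EvenMultiplicity G S)
theorem2p3 n G isG = mk⇔ code⇒evenMultiplicity evenMultiplicity⇒code
  where open PermutationModule isG
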